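{- Let $R$ be a nonvoid relation on $X\times Y$ and let $(\sigma,\gamma)\in P_R$. Let $Q=Q(\sigma,\gamma)$ be the relation modeling the link of $\sigma$ restricted to $\gamma$. Suppose $P_Q$ is well-defined and has reduced integral homology in dimension $k\geq 0$, that is, $\widetilde H_k(\Delta(P_Q);\mathbb{Z})\neq0$. Then there are at least $(k+2)!$ distinct informative attribute release sequences $y_1,\dots,y_\ell$ for $R$, each with $\ell\geq k+2$, such that $\psi_R(\{y_1,\dots,y_\ell\})=\sigma$. Consequently, $r_{\mathrm{slow}}(\sigma)\geq k+2$.
   Context: Everything is finite. A relation $R$ on $X\times Y$ is a subset of $X\times Y$; it is nonvoid if $X\neq\emptyset$ and $Y\ne\emptyset$. $Y_x=\{y\in Y:(x,y)\in R\}$ and $X_y=\{x\in X:(x,y)\in R\}$. For $\sigma\subseteq X$, $\phi_R(\sigma)=\bigcap_{x\in\sigma}Y_x$ with $\phi_R(\emptyset)=Y$; for $\gamma\subseteq Y$, $\psi_R(\gamma)=\bigcap_{y\in\gamma}X_y$ with $\psi_R(\emptyset)=X$. For nonvoid $R$, the Dowker complexes are $\Phi_R=\{\gamma\subseteq Y:\exists x\in X\ \forall y\in\gamma\ (x,y)\in R\}$ and $\Psi_R=\{\sigma\subseteq X:\exists y\in Y\ \forall x\in\sigma\ (x,y)\in R\}$. The doubly-labeled poset $P_R$ consists of all pairs $(\sigma,\gamma)$ with $\emptyset\neq\sigma\in\Psi_R$, $\emptyset\ne\gamma\in\Phi_R$, $\sigma=\psi_R(\gamma)$ and $\gamma=\phi_R(\sigma)$,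 ordered by $(\sigma_1,\gamma_1)\le(\sigma_2,\gamma_2)$ iff $\sigma_1\subseteq\sigma_2$. If a relation's Dowker complexes are both the empty complex $\{\emptyset\}$, its doubly-labeled poset is $\emptyset$; if they are void (no simplices), its doubly-labeled poset is undefined. For $\sigma\in\Psi_R$ and $\gamma\subseteq\phi_R(\sigma)$, the relation $Q(\sigma,\gamma)$ modeling the link of $\sigma$ restricted to $\gamma$ is the restriction of $R$ to $\overline X\times\gamma$ with $\overline X=\bigcup_{y\in\gamma}(X_y\setminus\sigma)$. Its Dowker complexes are defined in the standard way, except: if $\sigma=X$ they are void; if $\sigma\ne X$ but $\overline X=\emptyset$ they are $\{\emptyset\}$. An attribute release sequence for $R$ is a nonempty set of attributes of $Y$ released in a particular sequential order $y_1,\dots,y_m$ ($m\ge1$); it is informative if $y_i\notin(\phi_R\circ\psi_R)(\{y_1,\dots,y_{i-1}\})$ for all $1\le i\le m$. For $(\sigma,\gamma)\in P_R$, $r_{\mathrm{slow}}(\sigma)$ is the maximum $m$ for which there is an informative attribute release sequence $y_1,\dots,y_m$ for $R$ with $\psi_R(\{y_1,\dots,y_m\})=\sigma$. $\Delta(P)$ is the order complex of a poset $P$ (simplices are the chains of $P$); $\widetilde H_k$ is reduced simplicial homology. -}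

module Defs where

open import Algebra.Bundles using (AbelianGroup)
open import Data.Bool.Properties using () renaming (_≟_ to _≟ᵇ_)
open import Data.Fin using (Fin; zero; suc; toℕ)
open import Data.Fin.Properties using (all?; any?)
open import Data.Fin.Subset using
  (Subset; _∈_; _∉_; _⊆_; Nonempty; Empty; ⊥; ⁅_⁆; ⋃; _─_)
open import Data.Fin.Subset.Properties using
  (_∈?_; _⊆?_; ⊆-reflexive; ⊆-trans; ⊆-antisym)
open import Data.Integer using (ℤ; -_; _+_; _*_; 0ℤ; 1ℤ)
import Data.Integer.Properties as ℤ
open import Data.List using (List; []; _∷_; _++_; length; lookup; take)
  renaming (map to mapᴸ; tabulate to tabulateᴸ)
open import Data.List.Relation.Unary.All using () renaming (All to Allᴸ)
open import Data.List.Relation.Unary.Unique.Propositional using (Unique)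
open import Data.Nat using (ℕ; zero; suc; _≤_)
open import Data.Product using (Σ; ∃; ∃-syntax; _×_; _,_; proj₁; map₁)
open import Data.Vec using (Vec; []; _∷_; tabulate; removeAt)
import Data.Vec.Properties as Vec
open import Data.Vec.Relation.Binary.Pointwise.Inductive as Pointwise using (Pointwise)
open import Data.Vec.Relation.Unary.All using (All; []; _∷_)
open import Data.Vec.Relation.Unary.AllPairs using (AllPairs; []; _∷_)
open import Function using (_∘_)
open import Level using (0ℓ; _⊔_)
open import Relation.Binary.Bundles using (DecPoset)
open import Relation.Binary.Core using (REL)
import Relation.Binary.Construct.NonStrictToStrict as ToStrict
import Relation.Binary.Definitions as B
open import Relation.Binary.PropositionalEquality
  using (_≡_; _≢_; refl; sym; trans; cong; cong₂; module ≡-Reasoning)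
open import Relation.Nullary using (¬_; does; yes; no)
open import Relation.Nullary.Decidable using (_×-dec_; _→-dec_)
open import Relation.Unary using (Pred; Decidable)

module OrderComplex {c ℓ₁ ℓ₂} (P : DecPoset c ℓ₁ ℓ₂) where

  open DecPoset P using (Carrier; _≈_; _≟_) renaming (_≤_ to _≤ᴾ_)
  open ToStrict _≈_ _≤ᴾ_ using (_<_)

  -- A chain with n elements, listed in increasing order. This order
  -- orients the simplex. The index is the number of vertices, so that
  -- Simplex 0 contains just the empty simplex (of dimension -1), and a
  -- k-dimensional simplex is an element of Simplex (suc k).

  Simplex : ℕ → Set (c ⊔ ℓ₁ ⊔ ℓ₂)
  Simplex n = Σ (Vec Carrier n) (AllPairs _<_)

  SameSimplex : ∀ {n} → Simplex n → Simplex n → Set (c ⊔ ℓ₁)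
  SameSimplex (u , _) (v , _) = Pointwise _≈_ u v

  sameSimplex? : ∀ {n} → B.Decidable (SameSimplex {n})
  sameSimplex? (u , _) (v , _) = Pointwise.decidable _≟_ u v

  private
    removeAt⁺ : ∀ {n p} {Q : Pred Carrier p} {v : Vec Carrier (suc n)} →
                All Q v → ∀ i → All Q (removeAt v i)
    removeAt⁺ (_ ∷ q)          zero    = q
    removeAt⁺ (x ∷ q@(_ ∷ _)) (suc i) = x ∷ removeAt⁺ q i

    removeAt-chain : ∀ {n} {v : Vec Carrier (suc n)} →
                     AllPairs _<_ v → ∀ i → AllPairs _<_ (removeAt v i)
    removeAt-chain (_ ∷ q)          zero    = q
    removeAt-chain (x ∷ q@(_ ∷ _)) (suc i) =
      removeAt⁺ x i ∷ removeAt-chain q i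

  face : ∀ {n} → Simplex (suc n) → Fin (suc n) → Simplex n
  face (v , v-chain) i = removeAt v i , removeAt-chain v-chain i

  -- Integral simplicial chains, as formal sums. Two formal sums denote
  -- the same chain if every simplex has the same coefficient in both.

  FormalSum : ℕ → Set (c ⊔ ℓ₁ ⊔ ℓ₂)
  FormalSum n = List (ℤ × Simplex n)

  coefficient : ∀ {n} → FormalSum n → Simplex n → ℤ
  coefficient []            s = 0ℤ
  coefficient ((a , t) ∷ z) s with sameSimplex? t s
  ... | yes _ = a + coefficient z s
  ... | no  _ = coefficient z s

  infix 4 _≋_

  _≋_ : ∀ {n} → FormalSum n → FormalSum n → Set (c ⊔ ℓ₁ ⊔ ℓ₂)
  z ≋ w = ∀ s → coefficient z s ≡ coefficient w s

  neg : ∀ {n} → FormalSum n → FormalSum n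
  neg = mapᴸ (map₁ -_)

  sign : ∀ {n} → Fin n → ℤ
  sign zero    = 1ℤ
  sign (suc i) = - sign i

  ∂ : ∀ {n} → FormalSum (suc n) → FormalSum n
  ∂ []            = []
  ∂ ((a , s) ∷ z) = tabulateᴸ (λ i → sign i * a , face s i) ++ ∂ z

  Cycle : ℕ → Set (c ⊔ ℓ₁ ⊔ ℓ₂)
  Cycle n = Σ (FormalSum (suc n)) λ z → ∂ z ≋ []

  Homologous : ∀ {n} → Cycle n → Cycle n → Set (c ⊔ ℓ₁ ⊔ ℓ₂)
  Homologous {n} (z , _) (w , _) =
    Σ (FormalSum (suc (suc n))) λ u → ∂ u ≋ (z ++ neg w)

  private
    coefficient-++ : ∀ {n} (z w : FormalSum n) s →
      coefficient (z ++ w) s ≡ coefficient z s + coefficient w s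
    coefficient-++ []            w s = sym (ℤ.+-identityˡ _)
    coefficient-++ ((a , t) ∷ z) w s with sameSimplex? t s
    ... | yes _ = trans (cong (a +_) (coefficient-++ z w s))
                        (sym (ℤ.+-assoc a _ _))
    ... | no  _ = coefficient-++ z w s

    coefficient-neg : ∀ {n} (z : FormalSum n) s →
      coefficient (neg z) s ≡ - coefficient z s
    coefficient-neg []            s = refl
    coefficient-neg ((a , t) ∷ z) s with sameSimplex? t s
    ... | yes _ = trans (cong (- a +_) (coefficient-neg z s))
                        (sym (ℤ.neg-distrib-+ a _))
    ... | no  _ = coefficient-neg z s

    coefficient-∂-++ : ∀ {n} (z w : FormalSum (suc n)) s →
      coefficient (∂ (z ++ w)) s ≡ coefficient (∂ z) s + coefficient (∂ w) s
    coefficient-∂-++ []            w s = sym (ℤ.+-identityˡ _)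
    coefficient-∂-++ ((a , t) ∷ z) w s = begin
      coefficient (h ++ ∂ (z ++ w)) s
        ≡⟨ coefficient-++ h _ s ⟩
      coefficient h s + coefficient (∂ (z ++ w)) s
        ≡⟨ cong (coefficient h s +_) (coefficient-∂-++ z w s) ⟩
      coefficient h s + (coefficient (∂ z) s + coefficient (∂ w) s)
        ≡⟨ ℤ.+-assoc (coefficient h s) _ _ ⟨
      (coefficient h s + coefficient (∂ z) s) + coefficient (∂ w) s
        ≡⟨ cong (_+ coefficient (∂ w) s) (coefficient-++ h (∂ z) s) ⟨
      coefficient (h ++ ∂ z) s + coefficient (∂ w) s ∎
      where
      open ≡-Reasoning
      h = tabulateᴸ (λ i → sign i * a , face t i)

    coefficient-tabulate-neg : ∀ {m n} (f : Fin m → ℤ) (g : Fin m → Simplex n) a s →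
      coefficient (tabulateᴸ (λ i → f i * - a , g i)) s ≡
      - coefficient (tabulateᴸ (λ i → f i * a , g i)) s
    coefficient-tabulate-neg {zero}  f g a s = refl
    coefficient-tabulate-neg {suc m} f g a s with sameSimplex? (g zero) s
    ... | yes _ = trans
      (cong₂ _+_ (sym (ℤ.neg-distribʳ-* (f zero) a))
                 (coefficient-tabulate-neg (f ∘ suc) (g ∘ suc) a s))
      (sym (ℤ.neg-distrib-+ (f zero * a) _))
    ... | no  _ = coefficient-tabulate-neg (f ∘ suc) (g ∘ suc) a s

    coefficient-∂-neg : ∀ {n} (z : FormalSum (suc n)) s →
      coefficient (∂ (neg z)) s ≡ - coefficient (∂ z) s
    coefficient-∂-neg []            s = refl
    coefficient-∂-neg ((a , t) ∷ z) s = begin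
      coefficient (h′ ++ ∂ (neg z)) s
        ≡⟨ coefficient-++ h′ _ s ⟩
      coefficient h′ s + coefficient (∂ (neg z)) s
        ≡⟨ cong₂ _+_ (coefficient-tabulate-neg sign (face t) a s)
                     (coefficient-∂-neg z s) ⟩
      - coefficient h s + - coefficient (∂ z) s
        ≡⟨ ℤ.neg-distrib-+ (coefficient h s) _ ⟨
      - (coefficient h s + coefficient (∂ z) s)
        ≡⟨ cong -_ (coefficient-++ h (∂ z) s) ⟨
      - coefficient (h ++ ∂ z) s ∎
      where
      open ≡-Reasoning
      h  = tabulateᴸ (λ i → sign i * a , face t i)
      h′ = tabulateᴸ (λ i → sign i * - a , face t i)

    coefficient-minus : ∀ {n} (z w : FormalSum n) s →
      coefficient (z ++ neg w) s ≡ coefficient z s + - coefficient w s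
    coefficient-minus z w s =
      trans (coefficient-++ z (neg w) s)
            (cong (coefficient z s +_) (coefficient-neg w s))

    ≋⇒Homologous : ∀ {n} (z w : Cycle n) → proj₁ z ≋ proj₁ w → Homologous z w
    ≋⇒Homologous (z , _) (w , _) z≋w = [] , λ s → sym (begin
      coefficient (z ++ neg w) s           ≡⟨ coefficient-minus z w s ⟩
      coefficient z s + - coefficient w s  ≡⟨ cong (_+ - coefficient w s) (z≋w s) ⟩
      coefficient w s + - coefficient w s  ≡⟨ ℤ.+-inverseʳ (coefficient w s) ⟩
      0ℤ                                   ∎)
      where open ≡-Reasoning

    Homologous-sym : ∀ {n} (z w : Cycle n) → Homologous z w → Homologous w z
    Homologous-sym (z , _) (w , _) (u , ∂u) = neg u , λ s → begin
      coefficient (∂ (neg u)) s                  ≡⟨ coefficient-∂-neg u s ⟩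
      - coefficient (∂ u) s                      ≡⟨ cong -_ (trans (∂u s) (coefficient-minus z w s)) ⟩
      - (coefficient z s + - coefficient w s)    ≡⟨ ℤ.neg-distrib-+ (coefficient z s) _ ⟩
      - coefficient z s + - - coefficient w s    ≡⟨ cong (- coefficient z s +_) (ℤ.neg-involutive _) ⟩
      - coefficient z s + coefficient w s        ≡⟨ ℤ.+-comm (- coefficient z s) _ ⟩
      coefficient w s + - coefficient z s        ≡⟨ coefficient-minus w z s ⟨
      coefficient (w ++ neg z) s                 ∎
      where open ≡-Reasoning

    telescope : ∀ x y z → (x + - y) + (y + - z) ≡ x + - z
    telescope x y z = begin
      (x + - y) + (y + - z)  ≡⟨ ℤ.+-assoc x (- y) _ ⟩
      x + (- y + (y + - z))  ≡⟨ cong (x +_) (ℤ.+-assoc (- y) y (- z)) ⟨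
      x + ((- y + y) + - z)  ≡⟨ cong (λ t → x + (t + - z)) (ℤ.+-inverseˡ y) ⟩
      x + (0ℤ + - z)         ≡⟨ cong (x +_) (ℤ.+-identityˡ (- z)) ⟩
      x + - z                ∎
      where open ≡-Reasoning

    Homologous-trans : ∀ {n} (x y z : Cycle n) →
      Homologous x y → Homologous y z → Homologous x z
    Homologous-trans (x , _) (y , _) (z , _) (u , ∂u) (v , ∂v) = u ++ v , λ s → begin
      coefficient (∂ (u ++ v)) s
        ≡⟨ coefficient-∂-++ u v s ⟩
      coefficient (∂ u) s + coefficient (∂ v) s
        ≡⟨ cong₂ _+_ (trans (∂u s) (coefficient-minus x y s))
                     (trans (∂v s) (coefficient-minus y z s)) ⟩
      (coefficient x s + - coefficient y s) + (coefficient y s + - coefficient z s)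
        ≡⟨ telescope (coefficient x s) (coefficient y s) (coefficient z s) ⟩
      coefficient x s + - coefficient z s
        ≡⟨ coefficient-minus x z s ⟨
      coefficient (x ++ neg z) s ∎
      where open ≡-Reasoning

    interchange : ∀ a b c d → (a + b) + (c + d) ≡ (a + c) + (b + d)
    interchange a b c d = begin
      (a + b) + (c + d)  ≡⟨ ℤ.+-assoc a b _ ⟩
      a + (b + (c + d))  ≡⟨ cong (a +_) (ℤ.+-assoc b c d) ⟨
      a + ((b + c) + d)  ≡⟨ cong (λ t → a + (t + d)) (ℤ.+-comm b c) ⟩
      a + ((c + b) + d)  ≡⟨ cong (a +_) (ℤ.+-assoc c b d) ⟩
      a + (c + (b + d))  ≡⟨ ℤ.+-assoc a c _ ⟨
      (a + c) + (b + d)  ∎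
      where open ≡-Reasoning

  infixl 6 _⊕_

  _⊕_ : ∀ {n} → Cycle n → Cycle n → Cycle n
  (z , ∂z) ⊕ (w , ∂w) =
    z ++ w , λ s → trans (coefficient-∂-++ z w s) (cong₂ _+_ (∂z s) (∂w s))

  0ᶜ : ∀ {n} → Cycle n
  0ᶜ = [] , λ _ → refl

  ⊖_ : ∀ {n} → Cycle n → Cycle n
  ⊖ (z , ∂z) = neg z , λ s → trans (coefficient-∂-neg z s) (cong -_ (∂z s))

  private
    ⊕-cong : ∀ {n} (x x′ y y′ : Cycle n) →
      Homologous x x′ → Homologous y y′ → Homologous (x ⊕ y) (x′ ⊕ y′)
    ⊕-cong (x , _) (x′ , _) (y , _) (y′ , _) (u , ∂u) (v , ∂v) = u ++ v , λ s →
      let a = coefficient x s; a′ = coefficient x′ s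
          b = coefficient y s; b′ = coefficient y′ s in begin
      coefficient (∂ (u ++ v)) s
        ≡⟨ coefficient-∂-++ u v s ⟩
      coefficient (∂ u) s + coefficient (∂ v) s
        ≡⟨ cong₂ _+_ (trans (∂u s) (coefficient-minus x x′ s))
                     (trans (∂v s) (coefficient-minus y y′ s)) ⟩
      (a + - a′) + (b + - b′)
        ≡⟨ interchange a (- a′) b (- b′) ⟩
      (a + b) + (- a′ + - b′)
        ≡⟨ cong (a + b +_) (ℤ.neg-distrib-+ a′ b′) ⟨
      (a + b) + - (a′ + b′)
        ≡⟨ cong₂ (λ p q → p + - q) (coefficient-++ x y s) (coefficient-++ x′ y′ s) ⟨
      coefficient (x ++ y) s + - coefficient (x′ ++ y′) s
        ≡⟨ coefficient-minus (x ++ y) (x′ ++ y′) s ⟨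
      coefficient ((x ++ y) ++ neg (x′ ++ y′)) s ∎
      where open ≡-Reasoning

    ⊖-cong : ∀ {n} (x y : Cycle n) → Homologous x y → Homologous (⊖ x) (⊖ y)
    ⊖-cong (x , _) (y , _) (u , ∂u) = neg u , λ s → begin
      coefficient (∂ (neg u)) s                    ≡⟨ coefficient-∂-neg u s ⟩
      - coefficient (∂ u) s                        ≡⟨ cong -_ (trans (∂u s) (coefficient-minus x y s)) ⟩
      - (coefficient x s + - coefficient y s)      ≡⟨ ℤ.neg-distrib-+ (coefficient x s) _ ⟩
      - coefficient x s + - - coefficient y s      ≡⟨ cong₂ (λ p q → p + - q) (coefficient-neg x s) (coefficient-neg y s) ⟨
      coefficient (neg x) s + - coefficient (neg y) s ≡⟨ coefficient-minus (neg x) (neg y) s ⟨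
      coefficient (neg x ++ neg (neg y)) s         ∎
      where open ≡-Reasoning

    ⊕-assoc : ∀ {n} (x y z : Cycle n) → Homologous ((x ⊕ y) ⊕ z) (x ⊕ (y ⊕ z))
    ⊕-assoc X@(x , _) Y@(y , _) Z@(z , _) =
      ≋⇒Homologous ((X ⊕ Y) ⊕ Z) (X ⊕ (Y ⊕ Z)) λ s → begin
      coefficient ((x ++ y) ++ z) s
        ≡⟨ coefficient-++ (x ++ y) z s ⟩
      coefficient (x ++ y) s + coefficient z s
        ≡⟨ cong (_+ coefficient z s) (coefficient-++ x y s) ⟩
      (coefficient x s + coefficient y s) + coefficient z s
        ≡⟨ ℤ.+-assoc (coefficient x s) _ _ ⟩
      coefficient x s + (coefficient y s + coefficient z s)
        ≡⟨ cong (coefficient x s +_) (coefficient-++ y z s) ⟨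
      coefficient x s + coefficient (y ++ z) s
        ≡⟨ coefficient-++ x (y ++ z) s ⟨
      coefficient (x ++ (y ++ z)) s ∎
      where open ≡-Reasoning

    ⊕-comm : ∀ {n} (x y : Cycle n) → Homologous (x ⊕ y) (y ⊕ x)
    ⊕-comm X@(x , _) Y@(y , _) = ≋⇒Homologous (X ⊕ Y) (Y ⊕ X) λ s →
      trans (coefficient-++ x y s)
        (trans (ℤ.+-comm (coefficient x s) _) (sym (coefficient-++ y x s)))

    ⊕-identityˡ : ∀ {n} (x : Cycle n) → Homologous (0ᶜ ⊕ x) x
    ⊕-identityˡ x = ≋⇒Homologous (0ᶜ ⊕ x) x λ _ → refl

    ⊖-inverseˡ : ∀ {n} (x : Cycle n) → Homologous (⊖ x ⊕ x) 0ᶜ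
    ⊖-inverseˡ X@(x , _) = ≋⇒Homologous (⊖ X ⊕ X) 0ᶜ λ s →
      trans (coefficient-++ (neg x) x s)
        (trans (cong (_+ coefficient x s) (coefficient-neg x s))
               (ℤ.+-inverseˡ (coefficient x s)))

  -- Cycles modulo boundaries. Reducedness in dimension 0 comes from the
  -- augmentation ∂ : FormalSum 1 → FormalSum 0.

  H̃ : ℕ → AbelianGroup (c ⊔ ℓ₁ ⊔ ℓ₂) (c ⊔ ℓ₁ ⊔ ℓ₂)
  H̃ k = record
    { Carrier = Cycle k
    ; _≈_     = Homologous
    ; _∙_     = _⊕_
    ; ε       = 0ᶜ
    ; _⁻¹     = ⊖_
    ; isAbelianGroup = record
      { isGroup = record
        { isMonoid = record
          { isSemigroup = record
            { isMagma = record
              { isEquivalence = record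
                { refl  = λ {x} → ≋⇒Homologous x x λ _ → refl
                ; sym   = λ {x} {y} → Homologous-sym x y
                ; trans = λ {x} {y} {z} → Homologous-trans x y z
                }
              ; ∙-cong = λ {x} {x′} {y} {y′} → ⊕-cong x x′ y y′
              }
            ; assoc = ⊕-assoc
            }
          ; identity = ⊕-identityˡ , λ x →
              Homologous-trans (x ⊕ 0ᶜ) (0ᶜ ⊕ x) x (⊕-comm x 0ᶜ) (⊕-identityˡ x)
          }
        ; inverse = ⊖-inverseˡ , λ x →
            Homologous-trans (x ⊕ ⊖ x) (⊖ x ⊕ x) 0ᶜ (⊕-comm x (⊖ x)) (⊖-inverseˡ x)
        ; ⁻¹-cong = λ {x} {y} → ⊖-cong x y
        }
      ; comm = ⊕-comm
      }
    }

Nonzero : ∀ {c ℓ} → AbelianGroup c ℓ → Set (c ⊔ ℓ)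
Nonzero G = ∃ λ x → ¬ (x ≈ ε)
  where open AbelianGroup G

-- A relation on X × Y, for finite sets X ⊆ Fin m and Y ⊆ Fin n. Only
-- the pairs in X × Y count: the subset of X × Y meant is
-- {(x , y) ∈ X × Y ∣ x ∼ y}. In this way the restriction of a relation
-- is obtained by shrinking X and Y.

record Relation (m n : ℕ) : Set₁ where
  field
    X    : Subset m
    Y    : Subset n
    _∼_  : REL (Fin m) (Fin n) 0ℓ
    _∼?_ : B.Decidable _∼_

separate : ∀ {n p} {P : Pred (Fin n) p} → Decidable P → Subset n
separate P? = tabulate λ i → does (P? i)

module _ {m n} (R : Relation m n) where

  open Relation R

  Nonvoid : Set
  Nonvoid = Nonempty X × Nonempty Y

  X[_] : Fin n → Subset m
  X[ y ] = separate λ x → (x ∈? X) ×-dec (x ∼? y)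

  Y[_] : Fin m → Subset n
  Y[ x ] = separate λ y → (y ∈? Y) ×-dec (x ∼? y)

  φ : Subset m → Subset n
  φ σ = separate λ y → (y ∈? Y) ×-dec all? λ x → (x ∈? σ) →-dec (y ∈? Y[ x ])

  ψ : Subset n → Subset m
  ψ γ = separate λ x → (x ∈? X) ×-dec all? λ y → (y ∈? γ) →-dec (x ∈? X[ y ])

  Φ-standard : Pred (Subset n) 0ℓ
  Φ-standard γ = γ ⊆ Y × ∃[ x ] (x ∈ X × (∀ y → y ∈ γ → x ∼ y))

  Ψ-standard : Pred (Subset m) 0ℓ
  Ψ-standard σ = σ ⊆ X × ∃[ y ] (y ∈ Y × (∀ x → x ∈ σ → x ∼ y))

-- A relation together with its Dowker complexes. These are a separate
-- component because the relation modeling a link has its own convention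
-- for them in the degenerate cases.

record Dowker (m n : ℕ) : Set₁ where
  field
    relation : Relation m n
    Φ        : Pred (Subset n) 0ℓ
    Ψ        : Pred (Subset m) 0ℓ

standard : ∀ {m n} → Relation m n → Dowker m n
standard R = record { relation = R ; Φ = Φ-standard R ; Ψ = Ψ-standard R }

module _ {m n} (R : Relation m n) (σ : Subset m) (γ : Subset n) where

  open Relation R using (X; _∼_; _∼?_)

  X̄ : Subset m
  X̄ = separate λ x → any? λ y → (y ∈? γ) ×-dec (x ∈? (X[_] R y ─ σ))

  restriction : Relation m n
  restriction = record { X = X̄ ; Y = γ ; _∼_ = _∼_ ; _∼?_ = _∼?_ }

  -- There is no constructor for σ ≡ X: the complex is then void.

  data LinkComplex {l} (K : Pred (Subset l) 0ℓ) (τ : Subset l) : Set where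
    empty   : σ ≢ X → Empty X̄ → τ ≡ ⊥ → LinkComplex K τ
    regular : σ ≢ X → Nonempty X̄ → K τ → LinkComplex K τ

  Q : Dowker m n
  Q = record
    { relation = restriction
    ; Φ        = LinkComplex (Φ-standard restriction)
    ; Ψ        = LinkComplex (Ψ-standard restriction)
    }

module _ {m n} (D : Dowker m n) where

  open Dowker D

  WellDefined : Set
  WellDefined = ¬ ((∀ γ → ¬ Φ γ) × (∀ σ → ¬ Ψ σ))

  record InPoset (σ : Subset m) (γ : Subset n) : Set where
    field
      σ-nonempty : Nonempty σ
      σ∈Ψ        : Ψ σ
      γ-nonempty : Nonempty γ
      γ∈Φ        : Φ γ
      σ≡ψγ       : σ ≡ ψ relation γ
      γ≡φσ       : γ ≡ φ relation σ

  record Element : Set where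
    constructor element
    field
      σ       : Subset m
      γ       : Subset n
      inPoset : InPoset σ γ

  open Element

  private
    _≟ˢ_ : ∀ {l} → B.DecidableEquality (Subset l)
    _≟ˢ_ = Vec.≡-dec _≟ᵇ_

  doublyLabeledPoset : DecPoset 0ℓ 0ℓ 0ℓ
  doublyLabeledPoset = record
    { Carrier = Element
    ; _≈_     = λ p q → σ p ≡ σ q × γ p ≡ γ q
    ; _≤_     = λ p q → σ p ⊆ σ q
    ; isDecPartialOrder = record
      { isPartialOrder = record
        { isPreorder = record
          { isEquivalence = record
            { refl  = refl , refl
            ; sym   = λ (s , g) → sym s , sym g
            ; trans = λ (s , g) (s′ , g′) → trans s s′ , trans g g′
            }
          ; reflexive = λ (s , _) → ⊆-reflexive s
          ; trans     = ⊆-trans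
          }
        ; antisym = λ {p} {q} p⊆q q⊆p →
            let s = ⊆-antisym p⊆q q⊆p in
            s , trans (InPoset.γ≡φσ (inPoset p))
                  (trans (cong (φ relation) s) (sym (InPoset.γ≡φσ (inPoset q))))
        }
      ; _≟_  = λ p q → (σ p ≟ˢ σ q) ×-dec (γ p ≟ˢ γ q)
      ; _≤?_ = λ p q → σ p ⊆? σ q
      }
    }

fromList : ∀ {n} → List (Fin n) → Subset n
fromList ys = ⋃ (mapᴸ ⁅_⁆ ys)

module _ {m n} (R : Relation m n) where

  open Relation R

  record ReleaseSequence (ys : List (Fin n)) : Set where
    field
      nonempty : ys ≢ []
      distinct : Unique ys
      released : Allᴸ (_∈ Y) ys

  Informative : List (Fin n) → Set
  Informative ys = ∀ (i : Fin (length ys)) →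
    lookup ys i ∉ φ R (ψ R (fromList (take (toℕ i) ys)))

  record InformativeSequenceFor (σ : Subset m) (ys : List (Fin n)) : Set where
    field
      releaseSequence : ReleaseSequence ys
      informative     : Informative ys
      identifies      : ψ R (fromList ys) ≡ σ

  record IsRSlow (σ : Subset m) (r : ℕ) : Set where
    field
      attained : ∃[ ys ] (InformativeSequenceFor σ ys × length ys ≡ r)
      maximal  : ∀ ys → InformativeSequenceFor σ ys → length ys ≤ r

AtLeast : ∀ {a p} {A : Set a} → ℕ → Pred A p → Set (a ⊔ p)
AtLeast N P = ∃[ xs ] (Unique xs × Allᴸ P xs × N ≤ length xs)

-- Fix a released list δ and attributes V i ∈ γ still to be released, and let
-- Region δ V be the down-set of those (σ′ , γ′) ∈ P_Q with δ ⊆ γ′ and V i ∈ γ′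
-- for some i. For v = V i, removing v from V writes Region δ V as the union of
-- the smaller region and of the cone Contains (δ v); the two meet in the region
-- of δ v and the remaining attributes. By Mayer–Vietoris, v can be removed
-- without losing homology in dimension k unless the region of δ v has homology
-- in dimension k − 1. If no v can be removed, there are at least k + 2 choices
-- of v, since fewer cones cannot carry homology in dimension k, and by
-- induction (k + 1)! informative sequences continue each of them. A v that is
-- already inferable from δ can be removed, because the region is then a cone.

module Submission where

open import Defs
open import Data.Bool.Base using (if_then_else_)
open import Data.Bool.Properties using () renaming (_≟_ to _≟ᵇ_)
open import Data.Fin as Fin using (Fin; zero; suc; toℕ; punchIn; punchOut)
open import Data.Fin.Properties using
  (all?; any?; injective⇒≤; punchIn-injective; punchIn-punchOut)
open import Data.Fin.Subset using (Subset; _∈_; _∉_; _⊆_; _─_; inside; outside; ⁅_⁆)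
open import Data.Fin.Subset.Properties using
  (_∈?_; ⊆-antisym; p─q⊆p; x∈p∧x∉q⇒x∈p─q; x∈p∪q⁻; x∈p∪q⁺; x∈⁅x⁆; x∈⁅y⁆⇒x≡y; ∉⊥)
open import Data.Integer using (ℤ; -_; 0ℤ; 1ℤ)
import Data.Integer.Properties as ℤ
open import Data.Integer.Tactic.RingSolver using (solve-∀)
open import Data.List using
  (List; []; _∷_; _++_; _∷ʳ_; length; lookup; take; concat; filter; allFin)
  renaming (map to mapᴸ; tabulate to tabulateᴸ)
open import Data.List.Membership.Propositional using () renaming (_∈_ to _∈ᴸ_; _∉_ to _∉ᴸ_)
open import Data.List.Membership.Propositional.Properties using
  (∈-lookup; ∈-map⁻; ∈-filter⁺; ∈-filter⁻; ∈-allFin)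
open import Data.List.Properties using
  (≡-dec; ++-identityʳ; ∷ʳ-++; ∷-injectiveˡ; ∷-injectiveʳ; length-++; length-map;
   filter-reject; length-filter)
open import Data.List.Relation.Binary.Disjoint.Propositional using (Disjoint)
open import Data.List.Relation.Unary.All as Allᴸ using ([]; _∷_) renaming (All to Allᴸ)
import Data.List.Relation.Unary.All.Properties as Allᴸ
open import Data.List.Relation.Unary.AllPairs using ([]; _∷_; allPairs?)
import Data.List.Relation.Unary.AllPairs.Properties as AllPairsᴸ
open import Data.List.Relation.Unary.Any using (here; there; index)
open import Data.List.Relation.Unary.Any.Properties using (lookup-index; ++⁺ˡ; ++⁺ʳ)
open import Data.List.Relation.Unary.Unique.Propositional using (Unique)
import Data.List.Relation.Unary.Unique.Propositional.Properties as Unique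
open import Data.Nat using (ℕ; zero; suc; _≤_; _<_; z≤n; s≤s; s≤s⁻¹; _!)
import Data.Nat.Induction as ℕ
open import Data.Nat.Properties using
  (≤-refl; ≤-trans; m≤n⇒m<n∨m≡n; m≤n⇒m≤1+n; *-monoˡ-≤; +-mono-≤; +-comm; 1≤n!; n≤0⇒n≡0;
   _<?_; ≮⇒≥)
open import Data.Product using (∃; ∃-syntax; _×_; _,_; proj₁; proj₂; map₁)
open import Data.Sum using (_⊎_; inj₁; inj₂; [_,_]′)
open import Data.Unit.Polymorphic using (⊤)
open import Data.Vec using (Vec; []; _∷_; here; there; removeAt) renaming (_∷ʳ_ to _∷ʳᵛ_)
open import Data.Vec.Properties using (lookup∘tabulate; []=⇒lookup; lookup⇒[]=)
import Data.Vec.Properties as Vec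
open import Data.Vec.Relation.Binary.Pointwise.Inductive as Pointwise using (Pointwise; []; _∷_)
open import Data.Vec.Relation.Unary.All as All using (All; []; _∷_)
open import Data.Vec.Relation.Unary.AllPairs using (AllPairs; []; _∷_)
open import Function using (_∘_; id)
open import Function.Definitions using (Injective)
open import Induction.WellFounded using (Acc; acc)
open import Level using (_⊔_)
open import Relation.Binary.Bundles using (DecPoset)
import Relation.Binary.Construct.NonStrictToStrict as ToStrict
import Relation.Binary.Definitions as B
open import Relation.Binary.PropositionalEquality
  using (_≡_; _≢_; refl; sym; trans; cong; cong₂; subst; module ≡-Reasoning)
open import Relation.Nullary using (¬_; Dec; does; yes; no; contradiction; ¬?)
open import Relation.Nullary.Decidable using
  (_×-dec_; _→-dec_; map′; dec-true; decidable-stable)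
open import Relation.Unary using (Pred; Decidable; _∩_; _∪_)

-- Homology of order complexes

module OrderComplexHomology {c ℓ₁ ℓ₂} (P : DecPoset c ℓ₁ ℓ₂) where

  open import Data.Integer using (_+_; _*_; _-_)

  open DecPoset P using (Carrier; _≈_; _≟_; _≤?_; antisym; ≤-respˡ-≈; module Eq)
    renaming (_≤_ to _≤ᴾ_; reflexive to ≤ᴾ-reflexive; trans to ≤ᴾ-trans)
  open ToStrict _≈_ _≤ᴾ_ using (<-decidable; <-respˡ-≈) renaming (_<_ to _<ᴾ_)
  open OrderComplex P

  private
    -- Kept opaque so that goals go on mentioning `x <?ᴾ m` and do not unfold it into the decisions
    -- for `≤` and `≈`.
    abstract
      _<?ᴾ_ : B.Decidable _<ᴾ_
      _<?ᴾ_ = <-decidable _≟_ _≤?_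

    <ᴾ-respˡ = <-respˡ-≈ Eq.trans ≤-respˡ-≈

  -- Pairing formal sums with cochains.

  Cochain : ℕ → Set c
  Cochain n = Vec Carrier n → ℤ

  Respectful : ∀ {n} → Cochain n → Set (c ⊔ ℓ₁)
  Respectful f = ∀ {u v} → Pointwise _≈_ u v → f u ≡ f v

  -- A formal sum is determined up to ≋ by its pairings with respectful
  -- cochains (≋[]⇒⟨⟩≡0). Cochains live on arbitrary vectors, which makes the
  -- coboundary d recursive and spares all proofs that faces are chains.
  infix 8 ⟨_,_⟩

  ⟨_,_⟩ : ∀ {n} → Cochain n → FormalSum n → ℤ
  ⟨ f , [] ⟩              = 0ℤ
  ⟨ f , (a , s , _) ∷ z ⟩ = a * f s + ⟨ f , z ⟩

  ⟨⟩-++ : ∀ {n} (f : Cochain n) z w → ⟨ f , z ++ w ⟩ ≡ ⟨ f , z ⟩ + ⟨ f , w ⟩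
  ⟨⟩-++ f []                w = sym (ℤ.+-identityˡ _)
  ⟨⟩-++ f ((a , s , _) ∷ z) w =
    trans (cong (a * f s +_) (⟨⟩-++ f z w)) (sym (ℤ.+-assoc (a * f s) _ _))

  scale : ∀ {n} → ℤ → FormalSum n → FormalSum n
  scale b = mapᴸ (map₁ (b *_))

  ⟨⟩-scale : ∀ {n} (f : Cochain n) b z → ⟨ f , scale b z ⟩ ≡ b * ⟨ f , z ⟩
  ⟨⟩-scale f b []                = sym (ℤ.*-zeroʳ b)
  ⟨⟩-scale f b ((a , s , _) ∷ z) = trans (cong (b * a * f s +_) (⟨⟩-scale f b z))
                                         (distrib b a (f s) ⟨ f , z ⟩)
    where
    distrib : ∀ b a x y → b * a * x + b * y ≡ b * (a * x + y)
    distrib = solve-∀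

  ⟨⟩-neg : ∀ {n} (f : Cochain n) z → ⟨ f , neg z ⟩ ≡ - ⟨ f , z ⟩
  ⟨⟩-neg f []                = refl
  ⟨⟩-neg f ((a , s , _) ∷ z) = trans (cong (- a * f s +_) (⟨⟩-neg f z))
                                     (distrib a (f s) ⟨ f , z ⟩)
    where
    distrib : ∀ a x y → - a * x + - y ≡ - (a * x + y)
    distrib = solve-∀

  ⟨⟩-cong : ∀ {n} {f g : Cochain n} → (∀ v → f v ≡ g v) → ∀ z → ⟨ f , z ⟩ ≡ ⟨ g , z ⟩
  ⟨⟩-cong f≗g []                = refl
  ⟨⟩-cong f≗g ((a , s , _) ∷ z) = cong₂ _+_ (cong (a *_) (f≗g s)) (⟨⟩-cong f≗g z)

  indicator : ∀ {n} → Simplex n → Cochain n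
  indicator s v = if does (Pointwise.decidable _≟_ v (proj₁ s)) then 1ℤ else 0ℤ

  indicator-respectful : ∀ {n} (s : Simplex n) → Respectful (indicator s)
  indicator-respectful s {u} {v} u≈v
    with Pointwise.decidable _≟_ u (proj₁ s) | Pointwise.decidable _≟_ v (proj₁ s)
  ... | yes _   | yes _   = refl
  ... | no _    | no _    = refl
  ... | yes u≈s | no v≉s  =
    contradiction (Pointwise.trans Eq.trans (Pointwise.sym Eq.sym u≈v) u≈s) v≉s
  ... | no u≉s  | yes v≈s = contradiction (Pointwise.trans Eq.trans u≈v v≈s) u≉s

  coefficient≡⟨indicator⟩ : ∀ {n} (z : FormalSum n) s → coefficient z s ≡ ⟨ indicator s , z ⟩
  coefficient≡⟨indicator⟩ []            s = refl
  coefficient≡⟨indicator⟩ ((a , t) ∷ z) s with sameSimplex? t s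
  ... | yes _ = cong₂ _+_ (sym (ℤ.*-identityʳ a)) (coefficient≡⟨indicator⟩ z s)
  ... | no  _ = trans (coefficient≡⟨indicator⟩ z s)
                  (trans (sym (ℤ.+-identityˡ _)) (cong (_+ _) (sym (ℤ.*-zeroʳ a))))

  differs? : ∀ {n} (t : Simplex n) → Decidable λ (as : ℤ × Simplex n) → ¬ SameSimplex (proj₂ as) t
  differs? t (_ , s) = ¬? (sameSimplex? s t)

  others : ∀ {n} → Simplex n → FormalSum n → FormalSum n
  others t = filter (differs? t)

  ⟨⟩-others : ∀ {n} {f : Cochain n} → Respectful f → ∀ t z →
    ⟨ f , z ⟩ ≡ coefficient z t * f (proj₁ t) + ⟨ f , others t z ⟩
  ⟨⟩-others         resp t []            = refl
  ⟨⟩-others {f = f} resp t ((a , s) ∷ z) with sameSimplex? s t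
  ... | yes s≈t = trans (cong₂ _+_ (cong (a *_) (resp s≈t)) (⟨⟩-others resp t z))
                        (regroup a (coefficient z t) (f (proj₁ t)) _)
    where
    regroup : ∀ a b x y → a * x + (b * x + y) ≡ (a + b) * x + y
    regroup = solve-∀
  ... | no _ = trans (cong (a * f (proj₁ s) +_) (⟨⟩-others resp t z))
                     (regroup (a * f (proj₁ s)) (coefficient z t * f (proj₁ t)) _)
    where
    regroup : ∀ x y z → x + (y + z) ≡ y + (x + z)
    regroup = solve-∀

  -- Strong induction on the length of the list. All terms on the first listed simplex together
  -- contribute its coefficient, which is zero, times one value of `f`. Deleting them leaves a
  -- shorter list whose coefficients still vanish, because each coefficient is itself a pairing with
  -- a respectful cochain.
  ≋[]⇒⟨⟩≡0 : ∀ {n} {f : Cochain n} → Respectful f → ∀ z → z ≋ [] → ⟨ f , z ⟩ ≡ 0ℤ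
  ≋[]⇒⟨⟩≡0 {n} resp z = go resp z (ℕ.<-wellFounded _)
    where
    split : ∀ {f : Cochain n} → Respectful f → ∀ t z → z ≋ [] → ⟨ f , z ⟩ ≡ ⟨ f , others t z ⟩
    split {f} resp t z z≋0 =
      trans (⟨⟩-others resp t z)
        (trans (cong (λ b → b * f (proj₁ t) + ⟨ f , others t z ⟩) (z≋0 t)) (ℤ.+-identityˡ _))

    others≋[] : ∀ t z → z ≋ [] → others t z ≋ []
    others≋[] t z z≋0 s = begin
      coefficient (others t z) s     ≡⟨ coefficient≡⟨indicator⟩ (others t z) s ⟩
      ⟨ indicator s , others t z ⟩   ≡⟨ split (indicator-respectful s) t z z≋0 ⟨
      ⟨ indicator s , z ⟩            ≡⟨ coefficient≡⟨indicator⟩ z s ⟨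
      coefficient z s                ≡⟨ z≋0 s ⟩
      0ℤ                             ∎
      where open ≡-Reasoning

    shorter : ∀ a t (z : FormalSum n) → length (others t ((a , t) ∷ z)) < suc (length z)
    shorter a t z = subst (λ w → length w < suc (length z))
      (sym (filter-reject (differs? t) (λ t≉t → t≉t (Pointwise.refl Eq.refl))))
      (s≤s (length-filter (differs? t) z))

    go : ∀ {f : Cochain n} → Respectful f → ∀ z → Acc _<_ (length z) → z ≋ [] → ⟨ f , z ⟩ ≡ 0ℤ
    go resp []                  _         _   = refl
    go resp z@((a , t) ∷ z′) (acc rec) z≋0 =
      trans (split resp t z z≋0)
            (go resp (others t z) (rec (shorter a t z′)) (others≋[] t z z≋0))

  -- Omitting the first vertex leaves `v`; every other face keeps `x` and comes from a face of `v`,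
  -- with the sign flipped. On single vertices this is the dual of the augmentation.
  d : ∀ {n} → Cochain n → Cochain (suc n)
  d {zero}  f (x ∷ []) = f []
  d {suc n} f (x ∷ v)  = f v - d (f ∘ (x ∷_)) v

  d-cong : ∀ {n} {f g : Cochain n} → (∀ v → f v ≡ g v) → ∀ v → d f v ≡ d g v
  d-cong {zero}  f≗g (x ∷ []) = f≗g []
  d-cong {suc n} f≗g (x ∷ v)  = cong₂ _-_ (f≗g v) (d-cong (λ w → f≗g (x ∷ w)) v)

  d-respectful : ∀ {n} {f : Cochain n} → Respectful f → Respectful (d f)
  d-respectful {zero}  resp (x ∷ [])        = refl
  d-respectful {suc n} {f} resp {x ∷ u} {y ∷ v} (x≈y ∷ u≈v) = cong₂ _-_ (resp u≈v)
    (trans (d-cong (λ w → resp (x≈y ∷ Pointwise.refl Eq.refl)) u)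
           (d-respectful (λ p → resp (Eq.refl ∷ p)) u≈v))

  d-minus : ∀ {n} (f g : Cochain n) v → d (λ u → f u - g u) v ≡ d f v - d g v
  d-minus {zero}  f g (x ∷ []) = refl
  d-minus {suc n} f g (x ∷ v)  =
    trans (cong (λ e → f v - g v - e) (d-minus (f ∘ (x ∷_)) (g ∘ (x ∷_)) v))
          (regroup (f v) (g v) _ _)
    where
    regroup : ∀ a b p q → (a - b) - (p - q) ≡ (a - p) - (b - q)
    regroup = solve-∀

  -- Once the first vertex is peeled off, the two copies of `d f v` cancel, and what remains is the
  -- same identity for `f ∘ (x ∷_)`.
  d-d : ∀ {n} (f : Cochain n) v → d (d f) v ≡ 0ℤ
  d-d {zero}  f (x ∷ y ∷ []) = ℤ.+-inverseʳ (f [])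
  d-d {suc n} f (x ∷ v)      = begin
    d f v - d (λ u → f u - d (f ∘ (x ∷_)) u) v
      ≡⟨ cong (λ e → d f v - e) (d-minus f (d (f ∘ (x ∷_))) v) ⟩
    d f v - (d f v - d (d (f ∘ (x ∷_))) v)
      ≡⟨ cong (λ e → d f v - (d f v - e)) (d-d (f ∘ (x ∷_)) v) ⟩
    d f v - (d f v - 0ℤ)                         ≡⟨ cancel (d f v) ⟩
    0ℤ                                           ∎
    where
    open ≡-Reasoning
    cancel : ∀ x → x - (x - 0ℤ) ≡ 0ℤ
    cancel = solve-∀

  d-vanishes : ∀ {n p} {D : Pred Carrier p} {f : Cochain n} →
    (∀ {v} → All D v → f v ≡ 0ℤ) → ∀ {v} → All D v → d f v ≡ 0ℤ
  d-vanishes {zero}  f≡0 (_ ∷ [])  = f≡0 []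
  d-vanishes {suc n} f≡0 (Dx ∷ Dv) =
    cong₂ _-_ (f≡0 Dv) (d-vanishes (λ Du → f≡0 (Dx ∷ Du)) Dv)

  removeAt⁺ : ∀ {n p} {D : Pred Carrier p} {v : Vec Carrier (suc n)} →
              All D v → ∀ i → All D (removeAt v i)
  removeAt⁺ (_ ∷ q)          zero    = q
  removeAt⁺ (x ∷ q@(_ ∷ _)) (suc i) = x ∷ removeAt⁺ q i

  -- It suffices to treat one simplex. There `alternating` unrolls the recursion of `d` into the
  -- signed sum over the faces that `∂` lists.
  ⟨⟩-∂ : ∀ {n} (f : Cochain n) z → ⟨ f , ∂ z ⟩ ≡ ⟨ d f , z ⟩
  ⟨⟩-∂ f []            = refl
  ⟨⟩-∂ f ((a , s) ∷ z) =
    trans (⟨⟩-++ f (tabulateᴸ λ i → sign i * a , face s i) (∂ z))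
          (cong₂ _+_ (faces f a s) (⟨⟩-∂ f z))
    where
    sum : ∀ {n} → (Fin n → ℤ) → ℤ
    sum {zero}  g = 0ℤ
    sum {suc n} g = g zero + sum (g ∘ suc)

    sum-cong : ∀ {n} {g h : Fin n → ℤ} → (∀ i → g i ≡ h i) → sum g ≡ sum h
    sum-cong {zero}  g≗h = refl
    sum-cong {suc n} g≗h = cong₂ _+_ (g≗h zero) (sum-cong (g≗h ∘ suc))

    sum-neg : ∀ {n} (g : Fin n → ℤ) → sum (λ i → - g i) ≡ - sum g
    sum-neg {zero}  g = refl
    sum-neg {suc n} g =
      trans (cong (- g zero +_) (sum-neg (g ∘ suc))) (sym (ℤ.neg-distrib-+ (g zero) _))

    ⟨⟩-tabulate : ∀ {m n} (f : Cochain n) (b : Fin m → ℤ) (t : Fin m → Simplex n) →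
      ⟨ f , tabulateᴸ (λ i → b i , t i) ⟩ ≡ sum (λ i → b i * f (proj₁ (t i)))
    ⟨⟩-tabulate {zero}  f b t = refl
    ⟨⟩-tabulate {suc m} f b t =
      cong (b zero * f (proj₁ (t zero)) +_) (⟨⟩-tabulate f (b ∘ suc) (t ∘ suc))

    alternating : ∀ {n} (f : Cochain n) a v →
      sum (λ i → sign i * a * f (removeAt v i)) ≡ a * d f v
    alternating {zero}  f a (x ∷ [])      = base a (f [])
      where
      base : ∀ a b → 1ℤ * a * b + 0ℤ ≡ a * b
      base = solve-∀
    alternating {suc n} f a (x ∷ v@(_ ∷ _)) = begin
      1ℤ * a * f v + sum (λ i → - sign i * a * f (x ∷ removeAt v i))
        ≡⟨ cong (1ℤ * a * f v +_) (sum-cong λ i → pull (sign i) a (f (x ∷ removeAt v i))) ⟩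
      1ℤ * a * f v + sum (λ i → - (sign i * a * f (x ∷ removeAt v i)))
        ≡⟨ cong (1ℤ * a * f v +_) (sum-neg λ i → sign i * a * f (x ∷ removeAt v i)) ⟩
      1ℤ * a * f v - sum (λ i → sign i * a * f (x ∷ removeAt v i))
        ≡⟨ cong (λ e → 1ℤ * a * f v - e) (alternating (f ∘ (x ∷_)) a v) ⟩
      1ℤ * a * f v - a * d (f ∘ (x ∷_)) v
        ≡⟨ collect a (f v) _ ⟩
      a * (f v - d (f ∘ (x ∷_)) v) ∎
      where
      open ≡-Reasoning
      pull : ∀ s a b → - s * a * b ≡ - (s * a * b)
      pull = solve-∀
      collect : ∀ a b e → 1ℤ * a * b - a * e ≡ a * (b - e)
      collect = solve-∀

    faces : ∀ {n} (f : Cochain n) a s →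
      ⟨ f , tabulateᴸ (λ i → sign i * a , face s i) ⟩ ≡ a * d f (proj₁ s)
    faces f a s = trans (⟨⟩-tabulate f (λ i → sign i * a) (face s)) (alternating f a (proj₁ s))

  -- The condition concerns the listed terms, so even terms that cancel in the sum have to lie in
  -- `D`.
  Supported : ∀ {n p} → Pred Carrier p → FormalSum n → Set (c ⊔ ℓ₁ ⊔ ℓ₂ ⊔ p)
  Supported D = Allᴸ λ (_ , v , _) → All D v

  ∂-supported : ∀ {n p} {D : Pred Carrier p} {z : FormalSum (suc n)} →
    Supported D z → Supported D (∂ z)
  ∂-supported []       = []
  ∂-supported {z = (a , s) ∷ _} (Ds ∷ Dz) =
    Allᴸ.++⁺ (Allᴸ.tabulate⁺ {f = λ i → sign i * a , face s i} (removeAt⁺ Ds)) (∂-supported Dz)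

  ⟨⟩-vanishes : ∀ {n p} {D : Pred Carrier p} {f : Cochain n} →
    (∀ {v} → All D v → f v ≡ 0ℤ) → ∀ {z} → Supported D z → ⟨ f , z ⟩ ≡ 0ℤ
  ⟨⟩-vanishes f≡0 []                       = refl
  ⟨⟩-vanishes f≡0 (_∷_ {x = a , _} Ds Dz) =
    trans (cong₂ _+_ (cong (a *_) (f≡0 Ds)) (⟨⟩-vanishes f≡0 Dz))
          (trans (ℤ.+-identityʳ _) (ℤ.*-zeroʳ a))

  -- ∂ u and z as functionals on the cochains that respect ≈.
  Bounds : ∀ {n} → FormalSum (suc n) → FormalSum n → Set (c ⊔ ℓ₁)
  Bounds u z = ∀ {f} → Respectful f → ⟨ d f , u ⟩ ≡ ⟨ f , z ⟩

  -- The augmented complex ends with the empty simplex, so every multiple of it counts as a cycle.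
  IsCycle : ∀ {n} → FormalSum n → Set (c ⊔ ℓ₁)
  IsCycle {zero}  z = ⊤
  IsCycle {suc n} z = Bounds z []

  -- Here n counts vertices, so that Acyclic (suc k) is the vanishing of the
  -- reduced homology in dimension k, and Acyclic 0 says that D is inhabited.
  Acyclic : ∀ {p} → ℕ → Pred Carrier p → Set (c ⊔ ℓ₁ ⊔ ℓ₂ ⊔ p)
  Acyclic n D = ∀ (z : FormalSum n) → Supported D z → IsCycle z →
    ∃[ u ] Supported D u × Bounds u z

  -- Acyclicity bounds a cycle only as a functional on cochains; pairing with indicators turns this
  -- back into equality of coefficients, so the cycle is homologous to `0ᶜ`.
  Acyclic⇒¬Nonzero : ∀ {p k} {D : Pred Carrier p} → (∀ x → D x) →
    Acyclic (suc k) D → ¬ Nonzero (H̃ k)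
  Acyclic⇒¬Nonzero allD acyclic ((z , ∂z≋0) , z≁0)
    with acyclic z (Allᴸ.universal (λ (_ , v , _) → All.universal allD v) z)
           (λ {f} resp → trans (sym (⟨⟩-∂ f z)) (≋[]⇒⟨⟩≡0 resp (∂ z) ∂z≋0))
  ... | u , _ , ∂u≈z = z≁0 (u , λ s → begin
    coefficient (∂ u) s           ≡⟨ coefficient≡⟨indicator⟩ (∂ u) s ⟩
    ⟨ indicator s , ∂ u ⟩         ≡⟨ ⟨⟩-∂ (indicator s) u ⟩
    ⟨ d (indicator s) , u ⟩       ≡⟨ ∂u≈z (indicator-respectful s) ⟩
    ⟨ indicator s , z ⟩           ≡⟨ coefficient≡⟨indicator⟩ z s ⟨
    coefficient z s               ≡⟨ cong (λ w → coefficient w s) (++-identityʳ z) ⟨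
    coefficient (z ++ []) s       ∎)
    where open ≡-Reasoning

  Acyclic-resp : ∀ {p q n} {D : Pred Carrier p} {E : Pred Carrier q} →
    (∀ {x} → D x → E x) → (∀ {x} → E x → D x) → Acyclic n D → Acyclic n E
  Acyclic-resp D⊆E E⊆D acyclic z Ez z-cycle =
    let u , Du , ∂u≈z = acyclic z (Allᴸ.map (All.map E⊆D) Ez) z-cycle
    in  u , Allᴸ.map (All.map D⊆E) Du , ∂u≈z

  Acyclic-∅ : ∀ {p n} {D : Pred Carrier p} → (∀ {x} → ¬ D x) → Acyclic (suc n) D
  Acyclic-∅ ¬D [] [] _                                 = [] , [] , λ _ → refl
  Acyclic-∅ ¬D ((_ , _ ∷ _ , _) ∷ _) ((Dx ∷ _) ∷ _) _ = contradiction Dx ¬D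

  Supported₀ : ∀ {p} {D : Pred Carrier p} (z : FormalSum 0) → Supported D z
  Supported₀ []                 = []
  Supported₀ ((_ , [] , _) ∷ z) = [] ∷ Supported₀ z

  All-∷ʳ⁺ : ∀ {n p} {D : Pred Carrier p} {v : Vec Carrier n} {x} →
    All D v → D x → All D (v ∷ʳᵛ x)
  All-∷ʳ⁺ []        Dx = Dx ∷ []
  All-∷ʳ⁺ (Dy ∷ Dv) Dx = Dy ∷ All-∷ʳ⁺ Dv Dx

  chain-∷ʳ⁺ : ∀ {n m} {v : Vec Carrier n} →
    AllPairs _<ᴾ_ v → All (_<ᴾ m) v → AllPairs _<ᴾ_ (v ∷ʳᵛ m)
  chain-∷ʳ⁺ []         []          = [] ∷ []
  chain-∷ʳ⁺ (x<v ∷ ch) (x<m ∷ v<m) = All-∷ʳ⁺ x<v x<m ∷ chain-∷ʳ⁺ ch v<m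

  parity : ℕ → ℤ
  parity zero    = 1ℤ
  parity (suc n) = - parity n

  parity² : ∀ n → parity n * parity n ≡ 1ℤ
  parity² zero    = refl
  parity² (suc n) = trans (square (parity n)) (parity² n)
    where
    square : ∀ x → - x * - x ≡ x * x
    square = solve-∀

  -- Special to sums of empty simplices, which are supported in every region; in higher degrees a
  -- larger region may have new cycles.
  Acyclic₀-⊆ : ∀ {p q} {D : Pred Carrier p} {E : Pred Carrier q} →
    (∀ {x} → D x → E x) → Acyclic 0 D → Acyclic 0 E
  Acyclic₀-⊆ D⊆E acyclic z _ _ =
    let u , Du , ∂u≈z = acyclic z (Supported₀ z) _
    in  u , Allᴸ.map (All.map D⊆E) Du , ∂u≈z

  -- Joining chains with a top element.

  module Cone (m : Carrier) where

    -- A chain with a vertex not strictly below `m` is dropped: in a cone with top `m` it already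
    -- ends in `m`, and joining it with `m` would be degenerate.
    joinTop : ∀ {n} → FormalSum n → FormalSum (suc n)
    joinTop []                 = []
    joinTop ((a , v , ch) ∷ z) with All.all? (_<?ᴾ m) v
    ... | yes v<m = (a , v ∷ʳᵛ m , chain-∷ʳ⁺ ch v<m) ∷ joinTop z
    ... | no  _   = joinTop z

    joinTop-supported : ∀ {n p} {D : Pred Carrier p} → D m →
      ∀ {z : FormalSum n} → Supported D z → Supported D (joinTop z)
    joinTop-supported Dm []                               = []
    joinTop-supported Dm (_∷_ {x = _ , v , _} Dv Dz) with All.all? (_<?ᴾ m) v
    ... | yes _ = All-∷ʳ⁺ Dv Dm ∷ joinTop-supported Dm Dz
    ... | no  _ = joinTop-supported Dm Dz

    -- The transpose of joinTop.
    join* : ∀ {n} → Cochain (suc n) → Cochain n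
    join* f []      = f (m ∷ [])
    join* f (x ∷ v) = if does (x <?ᴾ m) then join* (f ∘ (x ∷_)) v else 0ℤ

    join*-< : ∀ {n} (f : Cochain (suc (suc n))) {x} → x <ᴾ m → ∀ v →
      join* f (x ∷ v) ≡ join* (f ∘ (x ∷_)) v
    join*-< f {x} x<m v with x <?ᴾ m
    ... | yes _   = refl
    ... | no  x≮m = contradiction x<m x≮m

    join*-∷ʳ : ∀ {n} (f : Cochain (suc n)) {v} → All (_<ᴾ m) v → join* f v ≡ f (v ∷ʳᵛ m)
    join*-∷ʳ f []                  = refl
    join*-∷ʳ f {x ∷ v} (x<m ∷ v<m) = trans (join*-< f x<m v) (join*-∷ʳ (f ∘ (x ∷_)) v<m)

    join*-0 : ∀ {n} (f : Cochain (suc n)) v → ¬ All (_<ᴾ m) v → join* f v ≡ 0ℤ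
    join*-0 f []      v≮m = contradiction [] v≮m
    join*-0 f (x ∷ v) v≮m with x <?ᴾ m
    ... | yes x<m = join*-0 (f ∘ (x ∷_)) v λ v<m → v≮m (x<m ∷ v<m)
    ... | no  _   = refl

    join*-minus : ∀ {n} (f g : Cochain (suc n)) v →
      join* (λ u → f u - g u) v ≡ join* f v - join* g v
    join*-minus f g []      = refl
    join*-minus f g (x ∷ v) with x <?ᴾ m
    ... | yes _ = join*-minus (f ∘ (x ∷_)) (g ∘ (x ∷_)) v
    ... | no  _ = refl

    join*-cong : ∀ {n} {f g : Cochain (suc n)} → (∀ v → f v ≡ g v) → ∀ v → join* f v ≡ join* g v
    join*-cong f≗g []      = f≗g (m ∷ [])
    join*-cong f≗g (x ∷ v) with x <?ᴾ m
    ... | yes _ = join*-cong (λ w → f≗g (x ∷ w)) v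
    ... | no  _ = refl

    join*-respectful : ∀ {n} {f : Cochain (suc n)} → Respectful f → Respectful (join* f)
    join*-respectful resp [] = refl
    join*-respectful {f = f} resp {x ∷ u} {y ∷ v} (x≈y ∷ u≈v) with x <?ᴾ m | y <?ᴾ m
    ... | yes _   | yes _   =
      trans (join*-cong (λ w → resp (x≈y ∷ Pointwise.refl Eq.refl)) u)
            (join*-respectful (λ p → resp (Eq.refl ∷ p)) u≈v)
    ... | no  _   | no  _   = refl
    ... | yes x<m | no  y≮m = contradiction (<ᴾ-respˡ x≈y x<m) y≮m
    ... | no  x≮m | yes y<m = contradiction (<ᴾ-respˡ (Eq.sym x≈y) y<m) x≮m

    ⟨⟩-joinTop : ∀ {n} (f : Cochain (suc n)) z → ⟨ f , joinTop z ⟩ ≡ ⟨ join* f , z ⟩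
    ⟨⟩-joinTop f []                = refl
    ⟨⟩-joinTop f ((a , v , _) ∷ z) with All.all? (_<?ᴾ m) v
    ... | yes v<m = cong₂ _+_ (cong (a *_) (sym (join*-∷ʳ f v<m))) (⟨⟩-joinTop f z)
    ... | no  v≮m = trans (⟨⟩-joinTop f z)
      (trans (sym (ℤ.+-identityˡ _))
             (cong (_+ ⟨ join* f , z ⟩)
                   (trans (sym (ℤ.*-zeroʳ a)) (cong (a *_) (sym (join*-0 f v v≮m))))))

    -- A strict chain below m contains m at most as its last vertex; if it does,
    -- appending m to its boundary gives back the chain itself.
    homotopy : ∀ {n} {f : Cochain (suc n)} → Respectful f → ∀ {v} →
      AllPairs _<ᴾ_ v → All (_≤ᴾ m) v →
      join* (d f) v ≡ d (join* f) v + parity (suc n) * f v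
    homotopy {n} {f} resp {x ∷ v} (x<v ∷ ch) (x≤m ∷ v≤m) with x <?ᴾ m
    homotopy {zero} {f} resp {x ∷ []} _ _ | yes x<m = begin
      f (m ∷ []) - f (x ∷ [])                    ≡⟨ negate (f (m ∷ [])) (f (x ∷ [])) ⟩
      f (m ∷ []) + - 1ℤ * f (x ∷ [])             ∎
      where
      open ≡-Reasoning
      negate : ∀ a b → a - b ≡ a + - 1ℤ * b
      negate = solve-∀
    homotopy {suc n} {f} resp {x ∷ v} (_ ∷ ch) (_ ∷ v≤m) | yes x<m = begin
      join* (λ u → f u - d (f ∘ (x ∷_)) u) v
        ≡⟨ join*-minus f (d (f ∘ (x ∷_))) v ⟩
      join* f v - join* (d (f ∘ (x ∷_))) v
        ≡⟨ cong (λ e → join* f v - e) (homotopy (λ p → resp (Eq.refl ∷ p)) ch v≤m) ⟩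
      join* f v - (d (join* (f ∘ (x ∷_))) v + parity (suc n) * f (x ∷ v))
        ≡⟨ regroup (join* f v) _ (parity (suc n)) (f (x ∷ v)) ⟩
      (join* f v - d (join* (f ∘ (x ∷_))) v) + - parity (suc n) * f (x ∷ v)
        ≡⟨ cong (λ e → join* f v - e + - parity (suc n) * f (x ∷ v)) (d-cong (join*-< f x<m) v) ⟨
      (join* f v - d (join* f ∘ (x ∷_)) v) + - parity (suc n) * f (x ∷ v) ∎
      where
      open ≡-Reasoning
      regroup : ∀ a b p y → a - (b + p * y) ≡ (a - b) + - p * y
      regroup = solve-∀
    homotopy {suc n} {f} resp {x ∷ y ∷ v} (((x≤y , x≉y) ∷ _) ∷ ch) (x≤m ∷ y≤m ∷ v≤m) | no x≮m =
      contradiction (antisym x≤y (≤ᴾ-trans y≤m (≤ᴾ-reflexive (Eq.sym x≈m)))) x≉y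
      where
      x≈m : x ≈ m
      x≈m = decidable-stable (x ≟ m) λ x≉m → x≮m (x≤m , x≉m)
    homotopy {zero} {f} resp {x ∷ []} _ (x≤m ∷ []) | no x≮m = begin
      0ℤ                                ≡⟨ cancel (f (m ∷ [])) ⟩
      f (m ∷ []) + - 1ℤ * f (m ∷ [])    ≡⟨ cong (λ e → f (m ∷ []) + - 1ℤ * e) (resp (x≈m ∷ [])) ⟨
      f (m ∷ []) + - 1ℤ * f (x ∷ [])    ∎
      where
      open ≡-Reasoning
      x≈m : x ≈ m
      x≈m = decidable-stable (x ≟ m) λ x≉m → x≮m (x≤m , x≉m)
      cancel : ∀ a → 0ℤ ≡ a + - 1ℤ * a
      cancel = solve-∀

  -- The join of a cycle with the top fills it up to sign: in `homotopy` the term with `d (join* f)`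
  -- dies on a cycle, which leaves the factor `parity n`, and scaling by the same sign removes it.
  -- For `n = 0` the filling is a multiple of the vertex `m`.
  Acyclic-cone : ∀ {n p} {D : Pred Carrier p} {m} → D m → (∀ {x} → D x → x ≤ᴾ m) → Acyclic n D
  Acyclic-cone {n} {D = D} {m} Dm D≤m z Dz z-cycle =
    scale (parity n) (joinTop z)
    , scale-supported (parity n) (joinTop-supported Dm Dz)
    , λ {f} resp → begin
      ⟨ d f , scale (parity n) (joinTop z) ⟩    ≡⟨ ⟨⟩-scale (d f) (parity n) (joinTop z) ⟩
      parity n * ⟨ d f , joinTop z ⟩            ≡⟨ cong (parity n *_) (⟨⟩-joinTop (d f) z) ⟩
      parity n * ⟨ join* (d f) , z ⟩            ≡⟨ cong (parity n *_) (bounds z Dz z-cycle resp) ⟩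
      parity n * (parity n * ⟨ f , z ⟩)         ≡⟨ ℤ.*-assoc (parity n) (parity n) _ ⟨
      parity n * parity n * ⟨ f , z ⟩           ≡⟨ cong (_* ⟨ f , z ⟩) (parity² n) ⟩
      1ℤ * ⟨ f , z ⟩                            ≡⟨ ℤ.*-identityˡ _ ⟩
      ⟨ f , z ⟩                                 ∎
    where
    open ≡-Reasoning
    open Cone m

    scale-supported : ∀ {n} b {z : FormalSum n} → Supported D z → Supported D (scale b z)
    scale-supported b Dz = Allᴸ.map⁺ (Allᴸ.map (λ Ds → Ds) Dz)

    termwise : ∀ {n} {f : Cochain (suc n)} → Respectful f → ∀ {z} → Supported D z →
      ⟨ join* (d f) , z ⟩ ≡ ⟨ d (join* f) , z ⟩ + parity (suc n) * ⟨ f , z ⟩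
    termwise {n} resp [] = sym (trans (ℤ.+-identityˡ _) (ℤ.*-zeroʳ (parity (suc n))))
    termwise {n} {f} resp {(a , s , ch) ∷ z} (Ds ∷ Dz) =
      trans (cong₂ (λ p q → a * p + q) (homotopy resp ch (All.map D≤m Ds)) (termwise resp Dz))
            (regroup a (d (join* f) s) (parity (suc n)) (f s) _ _)
      where
      regroup : ∀ a g b y p q → a * (g + b * y) + (p + b * q) ≡ (a * g + p) + b * (a * y + q)
      regroup = solve-∀

    bounds : ∀ {n} (z : FormalSum n) → Supported D z → IsCycle z →
      ∀ {f : Cochain n} → Respectful f →
      ⟨ join* (d f) , z ⟩ ≡ parity n * ⟨ f , z ⟩
    bounds {zero}  z Dz z-cycle {f} resp =
      trans (⟨⟩-cong (λ { [] → refl }) z) (sym (ℤ.*-identityˡ _))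
    bounds {suc n} z Dz z-cycle {f} resp =
      trans (termwise resp Dz)
        (trans (cong (_+ _) (z-cycle (join*-respectful resp))) (ℤ.+-identityˡ _))

  -- The union of two down-sets.

  module MayerVietoris {p q} {D : Pred Carrier p} {E : Pred Carrier q}
    (D? : Decidable D) (E? : Decidable E)
    (D-down : ∀ {x y} → x ≤ᴾ y → D y → D x) (E-down : ∀ {x y} → x ≤ᴾ y → E y → E x)
    where

    -- The largest vertex decides: a down-set that holds it holds the whole chain.
    chain-in-one : ∀ {n} {v : Vec Carrier n} → AllPairs _<ᴾ_ v → All (D ∪ E) v → All D v ⊎ All E v
    chain-in-one [] [] = inj₁ []
    chain-in-one {v = _ ∷ []} _ (inj₁ Dx ∷ []) = inj₁ (Dx ∷ [])
    chain-in-one {v = _ ∷ []} _ (inj₂ Ex ∷ []) = inj₂ (Ex ∷ [])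
    chain-in-one {v = _ ∷ _ ∷ _} (((x≤y , _) ∷ _) ∷ ch) (_ ∷ DEv) with chain-in-one ch DEv
    ... | inj₁ Dv@(Dy ∷ _) = inj₁ (D-down x≤y Dy ∷ Dv)
    ... | inj₂ Ev@(Ey ∷ _) = inj₂ (E-down x≤y Ey ∷ Ev)

    split : ∀ {n} {z : FormalSum n} → Supported (D ∪ E) z →
      ∃[ a ] ∃[ b ] Supported D a × Supported E b × (∀ f → ⟨ f , a ⟩ + ⟨ f , b ⟩ ≡ ⟨ f , z ⟩)
    split [] = [] , [] , [] , [] , λ _ → refl
    split (_∷_ {x = t@(c , v , ch)} DEs DEz) with split DEz | chain-in-one ch DEs
    ... | a , b , Da , Eb , eq | inj₁ Ds = t ∷ a , b , Ds ∷ Da , Eb , λ f →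
      trans (ℤ.+-assoc (c * f v) _ _) (cong (c * f v +_) (eq f))
    ... | a , b , Da , Eb , eq | inj₂ Es = a , t ∷ b , Da , Es ∷ Eb , λ f →
      trans (regroup ⟨ f , a ⟩ (c * f v) ⟨ f , b ⟩) (cong (c * f v +_) (eq f))
      where
      regroup : ∀ x y z → x + (y + z) ≡ y + (x + z)
      regroup = solve-∀

    inE : ∀ {n} → FormalSum n → FormalSum n
    inE = filter λ (_ , v , _) → All.all? E? v

    -- A test for what a sum has outside `E`: it pairs to zero with everything supported in `E`, and
    -- agrees with `f` on all other simplices.
    offE : ∀ {n} → Cochain n → Cochain n
    offE f v = if does (All.all? E? v) then 0ℤ else f v

    offE-vanishes : ∀ {n} (f : Cochain n) {v} → All E v → offE f v ≡ 0ℤ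
    offE-vanishes f {v} Ev with All.all? E? v
    ... | yes _   = refl
    ... | no  ¬Ev = contradiction Ev ¬Ev

    E-resp : ∀ {n} {u v : Vec Carrier n} → Pointwise _≈_ u v → All E u → All E v
    E-resp []          []        = []
    E-resp (x≈y ∷ u≈v) (Ex ∷ Eu) = E-down (≤ᴾ-reflexive (Eq.sym x≈y)) Ex ∷ E-resp u≈v Eu

    offE-respectful : ∀ {n} {f : Cochain n} → Respectful f → Respectful (offE f)
    offE-respectful resp {u} {v} u≈v with All.all? E? u | All.all? E? v
    ... | yes _  | yes _  = refl
    ... | no  _  | no  _  = resp u≈v
    ... | yes Eu | no ¬Ev = contradiction (E-resp u≈v Eu) ¬Ev
    ... | no ¬Eu | yes Ev = contradiction (E-resp (Pointwise.sym Eq.sym u≈v) Ev) ¬Eu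

    ⟨⟩-inE : ∀ {n} (f : Cochain n) z → ⟨ f , inE z ⟩ + ⟨ offE f , z ⟩ ≡ ⟨ f , z ⟩
    ⟨⟩-inE f []                = refl
    ⟨⟩-inE f ((a , v , _) ∷ z) with All.all? E? v
    ... | yes _ = trans (regroup a (f v) ⟨ f , inE z ⟩ _) (cong (a * f v +_) (⟨⟩-inE f z))
      where
      regroup : ∀ a x y z → (a * x + y) + (a * 0ℤ + z) ≡ a * x + (y + z)
      regroup = solve-∀
    ... | no  _ = trans (regroup ⟨ f , inE z ⟩ (a * f v) _) (cong (a * f v +_) (⟨⟩-inE f z))
      where
      regroup : ∀ x y z → x + (y + z) ≡ y + (x + z)
      regroup = solve-∀

    -- ∂ a lies in E as a chain since it cancels against ∂ b, although its
    -- faces, as listed, need not.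
    inE-∂ : ∀ {n} (a b : FormalSum (suc n)) → Supported E b → Bounds (a ++ b) [] →
      Bounds a (inE (∂ a))
    inE-∂ a b Eb ab-cycle {f} resp = begin
      ⟨ d f , a ⟩                                     ≡⟨ ⟨⟩-∂ f a ⟨
      ⟨ f , ∂ a ⟩                                     ≡⟨ ⟨⟩-inE f (∂ a) ⟨
      ⟨ f , inE (∂ a) ⟩ + ⟨ offE f , ∂ a ⟩            ≡⟨ cong (⟨ f , inE (∂ a) ⟩ +_) off≡0 ⟩
      ⟨ f , inE (∂ a) ⟩ + 0ℤ                          ≡⟨ ℤ.+-identityʳ _ ⟩
      ⟨ f , inE (∂ a) ⟩                               ∎
      where
      open ≡-Reasoning
      off≡0 : ⟨ offE f , ∂ a ⟩ ≡ 0ℤ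
      off≡0 = begin
        ⟨ offE f , ∂ a ⟩                              ≡⟨ ⟨⟩-∂ (offE f) a ⟩
        ⟨ d (offE f) , a ⟩                            ≡⟨ ℤ.+-identityʳ _ ⟨
        ⟨ d (offE f) , a ⟩ + 0ℤ
          ≡⟨ cong (⟨ d (offE f) , a ⟩ +_) (⟨⟩-vanishes (d-vanishes (offE-vanishes f)) Eb) ⟨
        ⟨ d (offE f) , a ⟩ + ⟨ d (offE f) , b ⟩       ≡⟨ ⟨⟩-++ (d (offE f)) a b ⟨
        ⟨ d (offE f) , a ++ b ⟩                       ≡⟨ ab-cycle (offE-respectful resp) ⟩
        0ℤ                                            ∎

    bounded⇒cycle : ∀ {n} (u : FormalSum (suc n)) z → Bounds u z → IsCycle z
    bounded⇒cycle {zero}  u z ∂u≈z = _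
    bounded⇒cycle {suc n} u z ∂u≈z {f} resp =
      trans (sym (∂u≈z (d-respectful resp))) (trans (⟨⟩-cong (d-d f) u) (⟨0⟩ u))
      where
      ⟨0⟩ : ∀ {n} (u : FormalSum n) → ⟨ (λ _ → 0ℤ) , u ⟩ ≡ 0ℤ
      ⟨0⟩ []            = refl
      ⟨0⟩ ((a , _) ∷ u) = cong₂ _+_ (ℤ.*-zeroʳ a) (⟨0⟩ u)

    -- For z = a + b, the cycle ∂ a = − ∂ b lies in D ∩ E, hence is ∂ c there;
    -- then a − c and b + c are cycles in D and E, and their sum is z.
    acyclic : ∀ {n} → Acyclic n (D ∩ E) → Acyclic (suc n) D → Acyclic (suc n) E →
      Acyclic (suc n) (D ∪ E)
    acyclic {n} D∩E-acyclic D-acyclic E-acyclic z DEz z-cycle =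
      let a , b , Da , Eb , a+b≈z = split DEz
          w = inE (∂ a)
          ab-cycle : Bounds (a ++ b) []
          ab-cycle {f} resp = trans (⟨⟩-++ (d f) a b) (trans (a+b≈z (d f)) (z-cycle resp))
          ∂a≈w : Bounds a w
          ∂a≈w = inE-∂ a b Eb ab-cycle
          Dw = Allᴸ.filter⁺ _ (∂-supported Da)
          Ew = Allᴸ.all-filter _ (∂ a)
          c , DEc , ∂c≈w = D∩E-acyclic w
            (Allᴸ.map All.zip (Allᴸ.zip (Dw , Ew)))
            (bounded⇒cycle a w ∂a≈w)
          u , Du , ∂u≈a-c = D-acyclic (a ++ neg c)
            (Allᴸ.++⁺ Da (Allᴸ.map⁺ (Allᴸ.map (λ s → All.map proj₁ s) DEc)))
            λ {f} resp → begin
              ⟨ d f , a ++ neg c ⟩              ≡⟨ ⟨⟩-minus (d f) a c ⟩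
              ⟨ d f , a ⟩ - ⟨ d f , c ⟩         ≡⟨ cong₂ _-_ (∂a≈w resp) (∂c≈w resp) ⟩
              ⟨ f , w ⟩ - ⟨ f , w ⟩             ≡⟨ ℤ.+-inverseʳ ⟨ f , w ⟩ ⟩
              0ℤ                                ∎
          v , Ev , ∂v≈b+c = E-acyclic (b ++ c)
            (Allᴸ.++⁺ Eb (Allᴸ.map (λ s → All.map proj₂ s) DEc))
            λ {f} resp → begin
              ⟨ d f , b ++ c ⟩                  ≡⟨ ⟨⟩-++ (d f) b c ⟩
              ⟨ d f , b ⟩ + ⟨ d f , c ⟩
                ≡⟨ cong (⟨ d f , b ⟩ +_) (trans (∂c≈w resp) (sym (∂a≈w resp))) ⟩
              ⟨ d f , b ⟩ + ⟨ d f , a ⟩         ≡⟨ ℤ.+-comm ⟨ d f , b ⟩ _ ⟩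
              ⟨ d f , a ⟩ + ⟨ d f , b ⟩         ≡⟨ a+b≈z (d f) ⟩
              ⟨ d f , z ⟩                       ≡⟨ z-cycle resp ⟩
              0ℤ                                ∎
      in  u ++ v
        , Allᴸ.++⁺ (Allᴸ.map (λ s → All.map inj₁ s) Du) (Allᴸ.map (λ s → All.map inj₂ s) Ev)
        , λ {f} resp → begin
            ⟨ d f , u ++ v ⟩                                         ≡⟨ ⟨⟩-++ (d f) u v ⟩
            ⟨ d f , u ⟩ + ⟨ d f , v ⟩
              ≡⟨ cong₂ _+_ (∂u≈a-c resp) (∂v≈b+c resp) ⟩
            ⟨ f , a ++ neg c ⟩ + ⟨ f , b ++ c ⟩
              ≡⟨ cong₂ _+_ (⟨⟩-minus f a c) (⟨⟩-++ f b c) ⟩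
            (⟨ f , a ⟩ - ⟨ f , c ⟩) + (⟨ f , b ⟩ + ⟨ f , c ⟩)
              ≡⟨ cancel ⟨ f , a ⟩ ⟨ f , b ⟩ ⟨ f , c ⟩ ⟩
            ⟨ f , a ⟩ + ⟨ f , b ⟩                                    ≡⟨ a+b≈z f ⟩
            ⟨ f , z ⟩                                                ∎
      where
      open ≡-Reasoning
      ⟨⟩-minus : ∀ {n} (f : Cochain n) x y → ⟨ f , x ++ neg y ⟩ ≡ ⟨ f , x ⟩ - ⟨ f , y ⟩
      ⟨⟩-minus f x y = trans (⟨⟩-++ f x (neg y)) (cong (⟨ f , x ⟩ +_) (⟨⟩-neg f y))
      cancel : ∀ a b c → (a - c) + (b + c) ≡ a + b
      cancel = solve-∀

open import Data.Nat using (_+_; _*_)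

-- Finite search and counting

first-or-all : ∀ {n p q} {P : Pred (Fin n) p} {Q : Pred (Fin n) q} →
  (∀ i → P i ⊎ Q i) → ∃ P ⊎ (∀ i → Q i)
first-or-all {zero}  h = inj₂ λ ()
first-or-all {suc n} h with h zero | first-or-all (h ∘ suc)
... | inj₁ p | _            = inj₁ (zero , p)
... | inj₂ _ | inj₁ (i , p) = inj₁ (suc i , p)
... | inj₂ q | inj₂ qs      = inj₂ λ { zero → q ; (suc i) → qs i }

search : ∀ {n p} {P : Pred (List (Fin n)) p} → Decidable P →
  ∀ r → Dec (∃[ ys ] P ys × length ys ≡ r)
search P? zero    = map′ (λ p → [] , p , refl) (λ { ([] , p , refl) → p }) (P? [])
search P? (suc r) = map′
  (λ (y , ys , p , eq) → y ∷ ys , p , cong suc eq)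
  (λ { (y ∷ ys , p , refl) → y , ys , p , refl })
  (any? λ y → search (P? ∘ (y ∷_)) r)

-- Search downward from the bound: a length that is not attained lowers the bound by one.
longest : ∀ {n p} {P : Pred (List (Fin n)) p} → Decidable P →
  ∀ b → (∀ ys → P ys → length ys ≤ b) → ∃ P →
  ∃[ r ] (∃[ ys ] P ys × length ys ≡ r) × (∀ ys → P ys → length ys ≤ r)
longest P? zero    bound (ys , p) = 0 , (ys , p , n≤0⇒n≡0 (bound ys p)) , bound
longest P? (suc b) bound (ys , p) with search P? (suc b)
... | yes attained = suc b , attained , bound
... | no  ¬attained = longest P? b
  (λ ys p → [ s≤s⁻¹ , (λ eq → contradiction (ys , p , eq) ¬attained) ]′ (m≤n⇒m<n∨m≡n (bound ys p)))
  (ys , p)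

lookup-injective : ∀ {a} {A : Set a} {xs : List A} → Unique xs → Injective _≡_ _≡_ (lookup xs)
lookup-injective (_ ∷ _)    {zero}  {zero}  _  = refl
lookup-injective (x∉xs ∷ _) {zero}  {suc j} eq = contradiction eq (Allᴸ.lookup x∉xs (∈-lookup j))
lookup-injective (x∉xs ∷ _) {suc i} {zero}  eq =
  contradiction (sym eq) (Allᴸ.lookup x∉xs (∈-lookup i))
lookup-injective (_ ∷ u)    {suc i} {suc j} eq = cong suc (lookup-injective u eq)

AtLeast-weaken : ∀ {a p q} {A : Set a} {P : Pred A p} {Q : Pred A q} {M N} →
  M ≤ N → (∀ {x} → P x → Q x) → AtLeast N P → AtLeast M Q
AtLeast-weaken M≤N P⊆Q (xs , u , ps , N≤) = xs , u , Allᴸ.map P⊆Q ps , ≤-trans M≤N N≤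

AtLeast⇒∃ : ∀ {a p} {A : Set a} {P : Pred A p} {N} → 1 ≤ N → AtLeast N P → ∃ P
AtLeast⇒∃ 1≤N (x ∷ _ , _ , p ∷ _ , _) = x , p
AtLeast⇒∃ 1≤N ([]    , _ , _ , N≤0) with ≤-trans 1≤N N≤0
... | ()

-- Lists from different blocks differ in their first entry, so the blocks are disjoint and their
-- sizes add up.
AtLeast-∷ : ∀ {a p} {A : Set a} {P : Pred (List A) p} {N M} {V : Fin N → A} →
  Injective _≡_ _≡_ V → (∀ i → AtLeast M (P ∘ (V i ∷_))) → AtLeast (N * M) P
AtLeast-∷ {A = A} {P} {V = V} V-inj h =
  concat (tabulateᴸ block)
  , Unique.concat⁺
      (Allᴸ.tabulate⁺ λ i → Unique.map⁺ ∷-injectiveʳ (proj₁ (proj₂ (h i))))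
      (AllPairsᴸ.tabulate⁺ disjoint)
  , Allᴸ.concat⁺ (Allᴸ.tabulate⁺ λ i → Allᴸ.map⁺ (proj₁ (proj₂ (proj₂ (h i)))))
  , size block (λ i → subst (_ ≤_) (sym (length-map (V i ∷_) (proj₁ (h i))))
                                   (proj₂ (proj₂ (proj₂ (h i)))))
  where
  block : Fin _ → List (List A)
  block i = mapᴸ (V i ∷_) (proj₁ (h i))

  disjoint : ∀ {i j} → i ≢ j → Disjoint (block i) (block j)
  disjoint i≢j (∈i , ∈j) with ∈-map⁻ _ ∈i | ∈-map⁻ _ ∈j
  ... | _ , _ , refl | _ , _ , eq = i≢j (V-inj (∷-injectiveˡ eq))

  size : ∀ {M N} (f : Fin N → List (List A)) → (∀ i → M ≤ length (f i)) →
    N * M ≤ length (concat (tabulateᴸ f))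
  size {N = zero}  f M≤ = z≤n
  size {N = suc N} f M≤ =
    subst (_ ≤_) (sym (length-++ (f zero))) (+-mono-≤ (M≤ zero) (size (f ∘ suc) (M≤ ∘ suc)))

-- The Galois connection of a relation

∈-separate⁺ : ∀ {n p} {P : Pred (Fin n) p} (P? : Decidable P) {i} → P i → i ∈ separate P?
∈-separate⁺ P? {i} p = lookup⇒[]= i _ (trans (lookup∘tabulate _ i) (dec-true (P? i) p))

∈-separate⁻ : ∀ {n p} {P : Pred (Fin n) p} (P? : Decidable P) {i} → i ∈ separate P? → P i
∈-separate⁻ P? {i} i∈ with P? i | trans (sym (lookup∘tabulate _ i)) ([]=⇒lookup i∈)
... | yes p | _  = p
... | no  _ | ()

x∈p─q⇒x∉q : ∀ {n} (p q : Subset n) {x} → x ∈ p ─ q → x ∉ q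
x∈p─q⇒x∉q (inside  ∷ p) (outside ∷ q) here         ()
x∈p─q⇒x∉q (_       ∷ p) (_       ∷ q) (there x∈) (there x∈q) = x∈p─q⇒x∉q p q x∈ x∈q

∈-fromList⁺ : ∀ {n} {ys : List (Fin n)} {y} → y ∈ᴸ ys → y ∈ fromList ys
∈-fromList⁺ (here refl) = x∈p∪q⁺ (inj₁ (x∈⁅x⁆ _))
∈-fromList⁺ (there y∈)  = x∈p∪q⁺ (inj₂ (∈-fromList⁺ y∈))

∈-fromList⁻ : ∀ {n} (ys : List (Fin n)) {y} → y ∈ fromList ys → y ∈ᴸ ys
∈-fromList⁻ []       y∈ = contradiction y∈ ∉⊥
∈-fromList⁻ (z ∷ ys) y∈ with x∈p∪q⁻ ⁅ z ⁆ (fromList ys) y∈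
... | inj₁ y∈z  = here (x∈⁅y⁆⇒x≡y z y∈z)
... | inj₂ y∈ys = there (∈-fromList⁻ ys y∈ys)

module _ {m n} (R : Relation m n) where

  open Relation R

  ∈-X[]⁺ : ∀ {x y} → x ∈ X → x ∼ y → x ∈ X[_] R y
  ∈-X[]⁺ {y = y} x∈X x∼y = ∈-separate⁺ (λ x → (x ∈? X) ×-dec (x ∼? y)) (x∈X , x∼y)

  ∈-X[]⁻ : ∀ {x y} → x ∈ X[_] R y → x ∈ X × x ∼ y
  ∈-X[]⁻ {y = y} = ∈-separate⁻ (λ x → (x ∈? X) ×-dec (x ∼? y))

  ∈-Y[]⁺ : ∀ {x y} → y ∈ Y → x ∼ y → y ∈ Y[_] R x
  ∈-Y[]⁺ {x} y∈Y x∼y = ∈-separate⁺ (λ y → (y ∈? Y) ×-dec (x ∼? y)) (y∈Y , x∼y)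

  ∈-Y[]⁻ : ∀ {x y} → y ∈ Y[_] R x → y ∈ Y × x ∼ y
  ∈-Y[]⁻ {x} = ∈-separate⁻ (λ y → (y ∈? Y) ×-dec (x ∼? y))

  ∈-φ⁺ : ∀ {σ y} → y ∈ Y → (∀ {x} → x ∈ σ → x ∼ y) → y ∈ φ R σ
  ∈-φ⁺ {σ} y∈Y σ∼y = ∈-separate⁺
    (λ y → (y ∈? Y) ×-dec all? λ x → (x ∈? σ) →-dec (y ∈? Y[_] R x))
    (y∈Y , λ x x∈σ → ∈-Y[]⁺ y∈Y (σ∼y x∈σ))

  ∈-φ⁻ : ∀ {σ y} → y ∈ φ R σ → y ∈ Y × (∀ {x} → x ∈ σ → x ∼ y)
  ∈-φ⁻ {σ} y∈φσ =
    let y∈Y , h = ∈-separate⁻ (λ y → (y ∈? Y) ×-dec all? λ x → (x ∈? σ) →-dec (y ∈? Y[_] R x)) y∈φσ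
    in  y∈Y , λ x∈σ → proj₂ (∈-Y[]⁻ (h _ x∈σ))

  ∈-ψ⁺ : ∀ {γ x} → x ∈ X → (∀ {y} → y ∈ γ → x ∼ y) → x ∈ ψ R γ
  ∈-ψ⁺ {γ} x∈X x∼γ = ∈-separate⁺
    (λ x → (x ∈? X) ×-dec all? λ y → (y ∈? γ) →-dec (x ∈? X[_] R y))
    (x∈X , λ y y∈γ → ∈-X[]⁺ x∈X (x∼γ y∈γ))

  ∈-ψ⁻ : ∀ {γ x} → x ∈ ψ R γ → x ∈ X × (∀ {y} → y ∈ γ → x ∼ y)
  ∈-ψ⁻ {γ} x∈ψγ =
    let x∈X , h = ∈-separate⁻ (λ x → (x ∈? X) ×-dec all? λ y → (y ∈? γ) →-dec (x ∈? X[_] R y)) x∈ψγ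
    in  x∈X , λ y∈γ → proj₂ (∈-X[]⁻ (h _ y∈γ))

  -- `γ ⊆ Y` puts `γ` below its closure `φ R (ψ R γ)`. The identity is what lets any nonempty list
  -- of attributes generate a cell in `top`.
  ψφψ : ∀ {γ} → γ ⊆ Y → ψ R γ ≡ ψ R (φ R (ψ R γ))
  ψφψ γ⊆Y = ⊆-antisym
    (λ x∈ψγ → ∈-ψ⁺ (proj₁ (∈-ψ⁻ x∈ψγ)) λ y∈φψγ → proj₂ (∈-φ⁻ y∈φψγ) x∈ψγ)
    (λ x∈ψφψγ → ∈-ψ⁺ (proj₁ (∈-ψ⁻ x∈ψφψγ)) λ y∈γ →
      proj₂ (∈-ψ⁻ x∈ψφψγ) (∈-φ⁺ (γ⊆Y y∈γ) λ x∈ψγ → proj₂ (∈-ψ⁻ x∈ψγ) y∈γ))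

-- Regions of the doubly-labeled poset of a link

module Link {m n} (R : Relation m n) (σ : Subset m) (γ : Subset n) (γ⊆Y : γ ⊆ Relation.Y R) where

  open Relation R

  Cell : Set
  Cell = Element (Q R σ γ)

  σ[_] : Cell → Subset m
  σ[_] = Element.σ

  γ[_] : Cell → Subset n
  γ[_] = Element.γ

  inPoset[_] : ∀ p → InPoset (Q R σ γ) σ[ p ] γ[ p ]
  inPoset[_] = Element.inPoset

  open OrderComplexHomology (doublyLabeledPoset (Q R σ γ))

  R′ : Relation m n
  R′ = restriction R σ γ

  ∈-X̄⁺ : ∀ {x y} → x ∈ X → x ∉ σ → y ∈ γ → x ∼ y → x ∈ X̄ R σ γ
  ∈-X̄⁺ x∈X x∉σ y∈γ x∼y = ∈-separate⁺
    (λ x → any? λ y → (y ∈? γ) ×-dec (x ∈? (X[_] R y ─ σ)))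
    (_ , y∈γ , x∈p∧x∉q⇒x∈p─q (∈-X[]⁺ R x∈X x∼y) x∉σ)

  ∈-X̄⁻ : ∀ {x} → x ∈ X̄ R σ γ → x ∈ X × x ∉ σ
  ∈-X̄⁻ x∈X̄ with ∈-separate⁻ (λ x → any? λ y → (y ∈? γ) ×-dec (x ∈? (X[_] R y ─ σ))) x∈X̄
  ... | y , _ , x∈ = proj₁ (∈-X[]⁻ R (p─q⊆p _ σ x∈)) , x∈p─q⇒x∉q (X[_] R y) σ x∈

  -- δ is not a face iff its release identifies σ: ψ R (fromList δ) ⊆ σ.
  Face : List (Fin n) → Set
  Face δ = ∃[ x ] x ∈ X × x ∉ σ × Allᴸ (x ∼_) δ

  face? : Decidable Face
  face? δ = any? λ x → (x ∈? X) ×-dec (¬? (x ∈? σ) ×-dec Allᴸ.all? (x ∼?_) δ)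

  Contains : List (Fin n) → Pred Cell _
  Contains δ p = Allᴸ (_∈ γ[ p ]) δ

  Meets : ∀ {N} → (Fin N → Fin n) → Pred Cell _
  Meets V p = ∃[ i ] V i ∈ γ[ p ]

  ∈-γ[]⁻ : ∀ p {y} → y ∈ γ[ p ] → y ∈ γ × (∀ {x} → x ∈ σ[ p ] → x ∼ y)
  ∈-γ[]⁻ p {y} y∈γp = ∈-φ⁻ R′ {σ[ p ]} (subst (y ∈_) (InPoset.γ≡φσ inPoset[ p ]) y∈γp)

  ∈-γ[]⁺ : ∀ p {y} → y ∈ γ → (∀ {x} → x ∈ σ[ p ] → x ∼ y) → y ∈ γ[ p ]
  ∈-γ[]⁺ p {y} y∈γ σp∼y = subst (y ∈_) (sym (InPoset.γ≡φσ inPoset[ p ])) (∈-φ⁺ R′ y∈γ σp∼y)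

  σ∼γ : ∀ p {x y} → x ∈ σ[ p ] → y ∈ γ[ p ] → x ∼ y
  σ∼γ p x∈σp y∈γp = proj₂ (∈-γ[]⁻ p y∈γp) x∈σp

  σ[]⊆X─σ : ∀ p {x} → x ∈ σ[ p ] → x ∈ X × x ∉ σ
  σ[]⊆X─σ p {x} x∈σp =
    ∈-X̄⁻ (proj₁ (∈-ψ⁻ R′ {γ[ p ]} (subst (x ∈_) (InPoset.σ≡ψγ inPoset[ p ]) x∈σp)))

  -- This makes `Contains δ` and all regions down-sets, as Mayer-Vietoris requires.
  γ[]-antitone : ∀ p q → σ[ p ] ⊆ σ[ q ] → γ[ q ] ⊆ γ[ p ]
  γ[]-antitone p q p⊆q y∈γq =
    let y∈γ , σq∼y = ∈-γ[]⁻ q y∈γq in ∈-γ[]⁺ p y∈γ (σq∼y ∘ p⊆q)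

  Contains⇒Face : ∀ {δ} p → Contains δ p → Face δ
  Contains⇒Face p δ⊆γp =
    let x , x∈σp = InPoset.σ-nonempty inPoset[ p ]
        x∈X , x∉σ = σ[]⊆X─σ p x∈σp
    in  x , x∈X , x∉σ , Allᴸ.map (σ∼γ p x∈σp) δ⊆γp

  module _ {δ v} (δ⊆γ : Allᴸ (_∈ γ) δ) (v∈δ : v ∈ᴸ δ) where

    ∈-ψδ⁺ : ∀ {x} → x ∈ X → x ∉ σ → Allᴸ (x ∼_) δ → x ∈ ψ R′ (fromList δ)
    ∈-ψδ⁺ x∈X x∉σ x∼δ =
      ∈-ψ⁺ R′ (∈-X̄⁺ x∈X x∉σ (Allᴸ.lookup δ⊆γ v∈δ) (Allᴸ.lookup x∼δ v∈δ))
              λ y∈δ → Allᴸ.lookup x∼δ (∈-fromList⁻ δ y∈δ)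

    -- The Galois closure of `δ` in the restricted relation. The face gives a member of `σᵗ` and
    -- shows `σ ≢ X`, so the complexes are `regular`; the listed `v` makes `γᵗ` nonempty and puts
    -- the members of `σᵗ` into `X̄`.
    top : Face δ → Cell
    top (x , x∈X , x∉σ , x∼δ) = element σᵗ γᵗ (record
      { σ-nonempty = x , x∈σᵗ
      ; σ∈Ψ        = regular σ≢X (x , x∈X̄)
          ((λ x′∈σᵗ → proj₁ (∈-ψ⁻ R′ x′∈σᵗ)) , v , Allᴸ.lookup δ⊆γ v∈δ , λ _ x′∈σᵗ →
            proj₂ (∈-ψ⁻ R′ x′∈σᵗ) (∈-fromList⁺ v∈δ))
      ; γ-nonempty = v , ∈-φ⁺ R′ (Allᴸ.lookup δ⊆γ v∈δ) λ x′∈σᵗ →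
          proj₂ (∈-ψ⁻ R′ x′∈σᵗ) (∈-fromList⁺ v∈δ)
      ; γ∈Φ        = regular σ≢X (x , x∈X̄)
          ((λ y∈γᵗ → proj₁ (∈-φ⁻ R′ y∈γᵗ)) , x , x∈X̄ , λ _ y∈γᵗ →
            proj₂ (∈-φ⁻ R′ y∈γᵗ) x∈σᵗ)
      ; σ≡ψγ       = ψφψ R′ λ y∈δ → Allᴸ.lookup δ⊆γ (∈-fromList⁻ δ y∈δ)
      ; γ≡φσ       = refl
      })
      where
      σᵗ = ψ R′ (fromList δ)
      γᵗ = φ R′ σᵗ
      x∈σᵗ : x ∈ σᵗ
      x∈σᵗ = ∈-ψδ⁺ x∈X x∉σ x∼δ
      x∈X̄ = proj₁ (∈-ψ⁻ R′ x∈σᵗ)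
      σ≢X : σ ≢ X
      σ≢X σ≡X = x∉σ (subst (x ∈_) (sym σ≡X) x∈X)

    top-contains : ∀ face → Contains δ (top face)
    top-contains face = Allᴸ.tabulate λ y∈δ →
      ∈-φ⁺ R′ (Allᴸ.lookup δ⊆γ y∈δ) λ x∈σᵗ → proj₂ (∈-ψ⁻ R′ x∈σᵗ) (∈-fromList⁺ y∈δ)

    top-max : ∀ face p → Contains δ p → σ[ p ] ⊆ σ[ top face ]
    top-max face p δ⊆γp x∈σp =
      let x∈X , x∉σ = σ[]⊆X─σ p x∈σp
      in  ∈-ψδ⁺ x∈X x∉σ (Allᴸ.map (σ∼γ p x∈σp) δ⊆γp)

    -- The cells that contain `δ` form a cone with apex `top face`; degree 0 is included.
    Contains-acyclic : Face δ → ∀ {j} → Acyclic j (Contains δ)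
    Contains-acyclic face = Acyclic-cone {m = top face} (top-contains face) λ {p} → top-max face p

  -- `δ` has been released and the index lists what follows, with informativeness measured in `R`
  -- and not in the restriction. One inclusion is enough at the end: attributes from `γ` never
  -- exclude a member of `ψ R γ`, which is `σ` in the theorem.
  data Releases (δ : List (Fin n)) : List (Fin n) → Set where
    done    : ψ R (fromList δ) ⊆ σ → Releases δ []
    release : ∀ {y ys} → y ∈ γ → y ∉ φ R (ψ R (fromList δ)) →
              Releases (δ ∷ʳ y) ys → Releases δ (y ∷ ys)

  ¬Face⇒ψ⊆σ : ∀ {δ} → ¬ Face δ → ψ R (fromList δ) ⊆ σ
  ¬Face⇒ψ⊆σ {δ} ¬face {x} x∈ψδ = decidable-stable (x ∈? σ) λ x∉σ →
    let x∈X , x∼δ = ∈-ψ⁻ R x∈ψδ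
    in  ¬face (x , x∈X , x∉σ , Allᴸ.tabulate (x∼δ ∘ ∈-fromList⁺))

  ∈-ψ-fromList⁺ : ∀ {δ x} → x ∈ X → Allᴸ (x ∼_) δ → x ∈ ψ R (fromList δ)
  ∈-ψ-fromList⁺ {δ} x∈X x∼δ = ∈-ψ⁺ R x∈X λ y∈δ → Allᴸ.lookup x∼δ (∈-fromList⁻ δ y∈δ)

  -- The individuals of a cell that contains `δ` lie in `ψ R (fromList δ)`, so they share every
  -- attribute inferable from `δ`.
  Contains-closed : ∀ {δ v} p → v ∈ γ → v ∈ φ R (ψ R (fromList δ)) →
    Contains δ p → Contains (δ ∷ʳ v) p
  Contains-closed p v∈γ v∈φψδ δ⊆γp = Allᴸ.∷ʳ⁺ δ⊆γp
    (∈-γ[]⁺ p v∈γ λ x∈σp → proj₂ (∈-φ⁻ R v∈φψδ)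
      (∈-ψ-fromList⁺ (proj₁ (σ[]⊆X─σ p x∈σp)) (Allᴸ.map (σ∼γ p x∈σp) δ⊆γp)))

  -- Needed in the contrapositive: an attribute that turns a face into a non-face cannot have been
  -- inferable.
  Face-closed : ∀ {δ v} → v ∈ φ R (ψ R (fromList δ)) → Face δ → Face (δ ∷ʳ v)
  Face-closed v∈φψδ (x , x∈X , x∉σ , x∼δ) =
    x , x∈X , x∉σ , Allᴸ.∷ʳ⁺ x∼δ (proj₂ (∈-φ⁻ R v∈φψδ) (∈-ψ-fromList⁺ x∈X x∼δ))

  ∈-∷ʳ : ∀ (δ : List (Fin n)) v → v ∈ᴸ δ ∷ʳ v
  ∈-∷ʳ δ v = ++⁺ʳ δ (here refl)

  _without_ : ∀ {N} → (Fin (suc N) → Fin n) → Fin (suc N) → Fin N → Fin n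
  (V without i) j = V (punchIn i j)

  Meets⇒ : ∀ {N} {V : Fin (suc N) → Fin n} i {p} → Meets V p → V i ∈ γ[ p ] ⊎ Meets (V without i) p
  Meets⇒ {V = V} i (j , Vj∈) with i Fin.≟ j
  ... | yes refl = inj₁ Vj∈
  ... | no  i≢j  = inj₂ (punchOut i≢j , subst (λ k → V k ∈ _) (sym (punchIn-punchOut i≢j)) Vj∈)

  Meets-without : ∀ {N} {V : Fin (suc N) → Fin n} i {p} → Meets (V without i) p → Meets V p
  Meets-without i (j , V∈) = punchIn i j , V∈

  Region : ∀ {N} → List (Fin n) → (Fin N → Fin n) → Pred Cell _
  Region δ V = Contains δ ∩ Meets V

  -- Removing one attribute from a region.

  module _ {N} {δ} {V : Fin (suc N) → Fin n} (δ⊆γ : Allᴸ (_∈ γ) δ) (V∈γ : ∀ i → V i ∈ γ) where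

    -- No cell contains `δ ∷ʳ V i`, so the region is the same with and without `V i`.
    drop-nonface : ∀ i → ¬ Face (δ ∷ʳ V i) → ∀ {j} →
      Acyclic j (Region δ (V without i)) → Acyclic j (Region δ V)
    drop-nonface i ¬face = Acyclic-resp
      (λ {p} (δ⊆ , meets) → δ⊆ , Meets-without i {p} meets)
      λ {p} (δ⊆ , meets) → δ⊆ ,
        [ (λ Vi∈ → contradiction (Contains⇒Face p (Allᴸ.∷ʳ⁺ δ⊆ Vi∈)) ¬face) , id ]′
          (Meets⇒ i {p} meets)

    -- The inclusion of `Contains (δ ∷ʳ V i)` in the region always holds, so the hypothesis makes
    -- the region equal to that cone.
    closed-acyclic : ∀ i → Face (δ ∷ʳ V i) → (∀ {p} → Region δ V p → Contains (δ ∷ʳ V i) p) →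
      ∀ {j} → Acyclic j (Region δ V)
    closed-acyclic i face ⊆Contains = Acyclic-resp
      (λ h → let δ⊆ , Vi∈ = Allᴸ.∷ʳ⁻ h in δ⊆ , i , Vi∈) (λ {p} → ⊆Contains {p})
      (Contains-acyclic (Allᴸ.∷ʳ⁺ δ⊆γ (V∈γ i)) (∈-∷ʳ δ (V i)) face)

    -- `link` concerns the intersection of the smaller region with the cone of `δ ∷ʳ V i`, hence the
    -- shift by one degree; the cone itself is acyclic in every degree.
    drop-acyclic-link : ∀ i → Face (δ ∷ʳ V i) → ∀ {j} →
      Acyclic j (Region (δ ∷ʳ V i) (V without i)) → Acyclic (suc j) (Region δ (V without i)) →
      Acyclic (suc j) (Region δ V)
    drop-acyclic-link i face link rest = Acyclic-resp
      (λ {p} →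
        [ (λ (δ⊆ , meets) → δ⊆ , Meets-without i {p} meets)
        , (λ h → let δ⊆ , Vi∈ = Allᴸ.∷ʳ⁻ h in δ⊆ , i , Vi∈) ]′)
      (λ {p} (δ⊆ , meets) →
        [ (λ Vi∈ → inj₂ (Allᴸ.∷ʳ⁺ δ⊆ Vi∈)) , (λ h → inj₁ (δ⊆ , h)) ]′ (Meets⇒ i {p} meets))
      (MayerVietoris.acyclic
        (λ p → Allᴸ.all? (_∈? γ[ p ]) δ ×-dec any? λ k → (V without i) k ∈? γ[ p ])
        (λ p → Allᴸ.all? (_∈? γ[ p ]) (δ ∷ʳ V i))
        (λ {p} {q} p≤q (δ⊆ , k , V∈) →
          Allᴸ.map (γ[]-antitone p q p≤q) δ⊆ , k , γ[]-antitone p q p≤q V∈)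
        (λ {p} {q} p≤q → Allᴸ.map (γ[]-antitone p q p≤q))
        (Acyclic-resp (λ (h , meets) → (proj₁ (Allᴸ.∷ʳ⁻ h) , meets) , h)
                      (λ ((_ , meets) , h) → h , meets) link)
        rest
        (Contains-acyclic (Allᴸ.∷ʳ⁺ δ⊆γ (V∈γ i)) (∈-∷ʳ δ (V i)) face))

  -- Induction on the number of cones: splitting off the first one leaves one cone fewer, and the
  -- intersection is again a region with one cone fewer, needed one degree lower.
  few⇒acyclic : ∀ {N j} {δ} {V : Fin N → Fin n} → Allᴸ (_∈ γ) δ → (∀ i → V i ∈ γ) →
    N ≤ suc j → Acyclic (suc j) (Region δ V)
  few⇒acyclic {zero} δ⊆γ V∈γ _ = Acyclic-∅ λ ()
  few⇒acyclic {suc N} {j} {δ} {V} δ⊆γ V∈γ (s≤s N≤j) with face? (δ ∷ʳ V zero)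
  few⇒acyclic {suc N} {j} δ⊆γ V∈γ (s≤s N≤j) | no ¬face =
    drop-nonface δ⊆γ V∈γ zero ¬face (few⇒acyclic δ⊆γ (V∈γ ∘ suc) (m≤n⇒m≤1+n N≤j))
  -- Here the intersection is empty, and so not acyclic in degree 0; but the region is the single
  -- cone itself.
  few⇒acyclic {suc zero} {zero} δ⊆γ V∈γ _ | yes face =
    closed-acyclic δ⊆γ V∈γ zero face λ { (δ⊆ , zero , V∈) → Allᴸ.∷ʳ⁺ δ⊆ V∈ }
  few⇒acyclic {suc N} {suc j} δ⊆γ V∈γ (s≤s N≤j) | yes face =
    drop-acyclic-link δ⊆γ V∈γ zero face
      (few⇒acyclic (Allᴸ.∷ʳ⁺ δ⊆γ (V∈γ zero)) (V∈γ ∘ suc) N≤j)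
      (few⇒acyclic δ⊆γ (V∈γ ∘ suc) (m≤n⇒m≤1+n N≤j))

  -- Indexed to match `Acyclic j`, so dimension `k` of the theorem is `j = suc k` and yields
  -- `(k + 2)!`.
  ManyReleases : ℕ → List (Fin n) → Set
  ManyReleases j δ = AtLeast ((suc j) !) λ ys → Releases δ ys × suc j ≤ length ys

  -- Induction on the number `N` of attributes. The bound `j < N` supplies enough first attributes
  -- for the factorial and passes to the shorter problem one degree lower.
  acyclic-or-many : ∀ {N j} {δ} {V : Fin N → Fin n} → Injective _≡_ _≡_ V →
    Allᴸ (_∈ γ) δ → (∀ i → V i ∈ γ) → Face δ → j < N →
    Acyclic j (Region δ V) ⊎ ManyReleases j δ
  acyclic-or-many {suc N} {zero} {δ} {V} V-inj δ⊆γ V∈γ faceδ _ with face? (δ ∷ʳ V zero)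
  -- Acyclicity in degree 0 only asks for one cell in the region, and this face provides it.
  ... | yes face = inj₁ (Acyclic₀-⊆
          (λ h → let δ⊆ , V∈ = Allᴸ.∷ʳ⁻ h in δ⊆ , zero , V∈)
          (Contains-acyclic (Allᴸ.∷ʳ⁺ δ⊆γ (V∈γ zero)) (∈-∷ʳ δ (V zero)) face))
  -- Releasing `V zero` alone leaves nobody outside `σ`.
  ... | no ¬face = inj₂
          ( (V zero ∷ []) ∷ [] , [] ∷ []
          , ( release (V∈γ zero) (λ V∈φψδ → ¬face (Face-closed V∈φψδ faceδ))
                (done (¬Face⇒ψ⊆σ ¬face))
            , ≤-refl) ∷ []
          , ≤-refl)
  acyclic-or-many {suc N} {suc j} {δ} {V} V-inj δ⊆γ V∈γ faceδ (s≤s j<N) with first-or-all step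
    where
    step : ∀ i →
      (Acyclic (suc j) (Region δ (V without i)) → Acyclic (suc j) (Region δ V)) ⊎
      AtLeast ((suc j) !) (λ ys → Releases δ (V i ∷ ys) × suc (suc j) ≤ suc (length ys))
    step i with face? (δ ∷ʳ V i) | V i ∈? φ R (ψ R (fromList δ))
    ... | no ¬face | _       = inj₁ (drop-nonface δ⊆γ V∈γ i ¬face)
    ... | yes face | yes V∈φψδ = inj₁ λ _ →
      closed-acyclic δ⊆γ V∈γ i face (λ {p} (δ⊆ , _) → Contains-closed p (V∈γ i) V∈φψδ δ⊆)
    ... | yes face | no V∉φψδ with acyclic-or-many (λ eq → punchIn-injective i _ _ (V-inj eq))
                                     (Allᴸ.∷ʳ⁺ δ⊆γ (V∈γ i)) (V∈γ ∘ punchIn i) face j<N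
    ...   | inj₁ link = inj₁ (drop-acyclic-link δ⊆γ V∈γ i face link)
    ...   | inj₂ many = inj₂
      (AtLeast-weaken ≤-refl (λ (r , l) → release (V∈γ i) V∉φψδ r , s≤s l) many)
  -- No attribute could be dropped: at least `j + 2` first attributes, each with `(j + 1)!`
  -- continuations, give `(j + 2)!` sequences.
  ... | inj₂ many = inj₂
    (AtLeast-weaken (*-monoˡ-≤ ((suc j) !) (s≤s j<N)) id (AtLeast-∷ V-inj many))
  -- After `V i` is dropped, either fewer than `j + 2` attributes remain, too few cones for
  -- homology, or the induction applies in the same degree.
  ... | inj₁ (i , drop) with suc j <? N
  ...   | no  j≮N = inj₁ (drop (few⇒acyclic δ⊆γ (V∈γ ∘ punchIn i) (≮⇒≥ j≮N)))
  ...   | yes j<N′ with acyclic-or-many (λ eq → punchIn-injective i _ _ (V-inj eq))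
                          δ⊆γ (V∈γ ∘ punchIn i) faceδ j<N′
  ...     | inj₁ rest = inj₁ (drop rest)
  ...     | inj₂ many = inj₂ many

  -- From releases to informative sequences.

  releases-fresh : ∀ {δ ys} → Allᴸ (_∈ γ) δ → Releases δ ys → Allᴸ (_∉ᴸ δ) ys
  releases-fresh δ⊆γ (done _)           = []
  releases-fresh δ⊆γ (release y∈γ y∉ r) =
    -- An attribute already in `δ` is inferable from `δ`, so an informative release cannot repeat
    -- it.
    (λ y∈δ → y∉ (∈-φ⁺ R (γ⊆Y y∈γ) λ x∈ψδ → proj₂ (∈-ψ⁻ R x∈ψδ) (∈-fromList⁺ y∈δ)))
    ∷ Allᴸ.map (λ ∉δy ∈δ → ∉δy (++⁺ˡ ∈δ)) (releases-fresh (Allᴸ.∷ʳ⁺ δ⊆γ y∈γ) r)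

  releases-unique : ∀ {δ ys} → Allᴸ (_∈ γ) δ → Releases δ ys → Unique ys
  releases-unique δ⊆γ (done _)          = []
  releases-unique {δ} δ⊆γ (release {y} y∈γ _ r) =
    Allᴸ.map (λ { ∉δy refl → ∉δy (∈-∷ʳ δ y) }) (releases-fresh (Allᴸ.∷ʳ⁺ δ⊆γ y∈γ) r)
    ∷ releases-unique (Allᴸ.∷ʳ⁺ δ⊆γ y∈γ) r

  releases-within : ∀ {δ ys} → Releases δ ys → Allᴸ (_∈ γ) ys
  releases-within (done _)          = []
  releases-within (release y∈γ _ r) = y∈γ ∷ releases-within r

  releases-end : ∀ {δ ys} → Releases δ ys → ψ R (fromList (δ ++ ys)) ⊆ σ
  releases-end {δ} (done ψδ⊆σ) = subst (λ l → ψ R (fromList l) ⊆ σ) (sym (++-identityʳ δ)) ψδ⊆σ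
  releases-end {δ} (release {y} {ys} _ _ r) =
    subst (λ l → ψ R (fromList l) ⊆ σ) (∷ʳ-++ δ y ys) (releases-end r)

  releases-informative : ∀ {δ ys} → Releases δ ys → ∀ (i : Fin (length ys)) →
    lookup ys i ∉ φ R (ψ R (fromList (δ ++ take (toℕ i) ys)))
  releases-informative {δ} (release {y} _ y∉ r) zero =
    subst (λ l → y ∉ φ R (ψ R (fromList l))) (sym (++-identityʳ δ)) y∉
  releases-informative {δ} (release {y} {ys} _ _ r) (suc i) =
    subst (λ l → lookup ys i ∉ φ R (ψ R (fromList l))) (∷ʳ-++ δ y (take (toℕ i) ys))
      (releases-informative r i)

  releases⇒informative : σ ≡ ψ R γ → ∀ {ys} → ys ≢ [] → Releases [] ys →
    InformativeSequenceFor R σ ys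
  releases⇒informative σ≡ψγ {ys} ys≢[] r = record
    { releaseSequence = record
      { nonempty = ys≢[]
      ; distinct = releases-unique [] r
      ; released = Allᴸ.map γ⊆Y (releases-within r)
      }
    ; informative = releases-informative r
    ; identifies  = ⊆-antisym (releases-end r) λ {x} x∈σ →
        let x∈X , x∼γ = ∈-ψ⁻ R {γ} (subst (x ∈_) σ≡ψγ x∈σ)
        in  ∈-ψ⁺ R x∈X λ y∈ys → x∼γ (Allᴸ.lookup (releases-within r) (∈-fromList⁻ ys y∈ys))
    }

-- Existence of a longest informative sequence.

informativeSequenceFor? : ∀ {m n} (R : Relation m n) σ → Decidable (InformativeSequenceFor R σ)
informativeSequenceFor? R σ ys = map′
  (λ (ne , u , rel , inf , idf) → record
    { releaseSequence = record { nonempty = ne ; distinct = u ; released = rel }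
    ; informative = inf ; identifies = idf })
  (λ s → let open InformativeSequenceFor s; open ReleaseSequence releaseSequence in
    nonempty , distinct , released , informative , identifies)
  (¬? (≡-dec Fin._≟_ ys [])
    ×-dec allPairs? (λ x y → ¬? (x Fin.≟ y)) ys
    ×-dec Allᴸ.all? (_∈? Relation.Y R) ys
    ×-dec all? (λ i → ¬? (lookup ys i ∈? φ R (ψ R (fromList (take (toℕ i) ys)))))
    ×-dec Vec.≡-dec _≟ᵇ_ (ψ R (fromList ys)) σ)

Unique⇒length≤ : ∀ {n} {ys : List (Fin n)} → Unique ys → length ys ≤ n
Unique⇒length≤ u = injective⇒≤ (lookup-injective u)

-- Distinctness bounds the length by `n`, and the property is decidable, so `longest` finds the
-- maximum.
isRSlow : ∀ {m n} (R : Relation m n) {σ} → ∃ (InformativeSequenceFor R σ) → ∃ (IsRSlow R σ)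
isRSlow {n = n} R {σ} inf =
  let open InformativeSequenceFor
      open ReleaseSequence
      r , attained , maximal = longest (informativeSequenceFor? R σ) n
        (λ _ s → Unique⇒length≤ (distinct (releaseSequence s))) inf
  in  r , record { attained = attained ; maximal = maximal }

corollary28 : ∀ {m n} (R : Relation m n) → Nonvoid R →
    (σ : Subset m) (γ : Subset n) → InPoset (standard R) σ γ →
    (k : ℕ) → WellDefined (Q R σ γ) →
    Nonzero (OrderComplex.H̃ (doublyLabeledPoset (Q R σ γ)) k) →
    AtLeast ((k + 2) !) (λ ys → InformativeSequenceFor R σ ys × k + 2 ≤ length ys)
    × (∃[ r ] (IsRSlow R σ r × k + 2 ≤ r))
corollary28 {m} {n} R _ σ γ inP k wellDefined H̃≠0 = many , r , rSlow , k+2≤r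
  where
  open Relation R

  γ⊆Y : γ ⊆ Y
  γ⊆Y = proj₁ (InPoset.γ∈Φ inP)

  open Link R σ γ γ⊆Y
  open OrderComplexHomology (doublyLabeledPoset (Q R σ γ)) using (Acyclic; Acyclic⇒¬Nonzero)

  V-list : List (Fin n)
  V-list = filter (_∈? γ) (allFin n)

  V : Fin (length V-list) → Fin n
  V = lookup V-list

  V-injective : Injective _≡_ _≡_ V
  V-injective = lookup-injective (Unique.filter⁺ (_∈? γ) (Unique.allFin⁺ n))

  V∈γ : ∀ i → V i ∈ γ
  V∈γ i = proj₂ (∈-filter⁻ (_∈? γ) {xs = allFin n} (∈-lookup i))

  -- With nothing released and all of `γ` pending, the region is the whole poset, since each cell
  -- has some attribute.
  covered : ∀ p → Region [] V p
  covered p =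
    let y , y∈γp = InPoset.γ-nonempty inPoset[ p ]
        y∈V = ∈-filter⁺ (_∈? γ) (∈-allFin y) (proj₁ (∈-γ[]⁻ p y∈γp))
    in  [] , index y∈V , subst (_∈ γ[ p ]) (lookup-index y∈V) y∈γp

  -- The empty list is a face unless `σ` is all of `X`; in that case `LinkComplex` has no simplices
  -- and the poset would be undefined.
  face : Face []
  face = decidable-stable (face? []) λ ¬face →
    let σ≡X : σ ≡ X
        σ≡X = ⊆-antisym (proj₁ (InPoset.σ∈Ψ inP)) λ {x} x∈X →
          decidable-stable (x ∈? σ) λ x∉σ → ¬face (x , x∈X , x∉σ , [])
    in  wellDefined ( (λ { _ (empty σ≢X _ _) → σ≢X σ≡X ; _ (regular σ≢X _ _) → σ≢X σ≡X })
                    , (λ { _ (empty σ≢X _ _) → σ≢X σ≡X ; _ (regular σ≢X _ _) → σ≢X σ≡X }))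

  ¬acyclic : ¬ Acyclic (suc k) (Region [] V)
  ¬acyclic acyclic = Acyclic⇒¬Nonzero covered acyclic H̃≠0

  manyReleases : ManyReleases (suc k) []
  -- The homology forces `γ` to have at least `k + 2` attributes, the number that the dichotomy
  -- starts from.
  manyReleases with suc k <? length V-list
  ... | no  k≮N = contradiction (few⇒acyclic [] V∈γ (≮⇒≥ k≮N)) ¬acyclic
  ... | yes k<N with acyclic-or-many V-injective [] V∈γ face k<N
  ...   | inj₁ acyclic = contradiction acyclic ¬acyclic
  ...   | inj₂ releases = releases

  many : AtLeast ((k + 2) !) (λ ys → InformativeSequenceFor R σ ys × k + 2 ≤ length ys)
  many = subst (λ l → AtLeast (l !) λ ys → InformativeSequenceFor R σ ys × l ≤ length ys)
    (+-comm 2 k)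
    (AtLeast-weaken ≤-refl
      (λ { (r , l) →
        releases⇒informative (InPoset.σ≡ψγ inP) (λ { refl → contradiction l λ () }) r , l })
      manyReleases)

  sequence = AtLeast⇒∃ (1≤n! (k + 2)) many

  rSlow∃ = isRSlow R (proj₁ sequence , proj₁ (proj₂ sequence))
  r = proj₁ rSlow∃
  rSlow = proj₂ rSlow∃

  k+2≤r : k + 2 ≤ r
  k+2≤r = ≤-trans (proj₂ (proj₂ sequence)) (IsRSlow.maximal rSlow _ (proj₁ (proj₂ sequence)))
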